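{- For all positive integers $m,q$ with $mq>1$, $$\pi_f(K_{m+1,qm})=3\left(1-\frac{(q+1)m-2}{(2m+1)mq-m-2}\right).$$
   Context: $K_{a,b}$ is the complete bipartite graph with parts of sizes $a$ and $b$. Two edges are nonincident if they share no endpoint. A linear ordering of $V(G)$ separates a pair of nonincident edges if both endpoints of one edge precede both endpoints of the other. $\pi_t(G)$ is the minimum length of a list of linear orderings of $V(G)$ (repetitions allowed) separating every pair of nonincident edges at least $t$ times, and the fractional separation dimension is $\pi_f(G)=\liminf_{t\to\infty}\pi_t(G)/t$. -}

module Defs where

open import Data.Nat as ℕ using (ℕ; zero; suc; _<ᵇ_; _⊔_; _⊓_)
open import Data.Fin using (Fin; toℕ)
open import Data.Sum using (_⊎_; inj₁; inj₂)
open import Data.Product using (_×_; _,_; Σ; ∃; proj₁; proj₂)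
open import Data.Bool using (Bool; _∨_)
open import Data.List using (List; length; filterᵇ)
open import Data.Integer using (ℤ; +_)
open import Data.Rational as ℚ using (ℚ; 0ℚ; _÷_)
open import Data.Rational.Properties using () renaming (_≟_ to _≟ℚ_)
open import Function.Bundles using (_↔_; Inverse)
open import Relation.Binary.PropositionalEquality using (_≡_; _≢_)
open import Relation.Nullary using (yes; no)

Vertex : ℕ → ℕ → Set
Vertex a b = Fin a ⊎ Fin b

-- Edges of K_{a,b}: exactly one edge {inj₁ i, inj₂ j} for each i, j.
Edge : ℕ → ℕ → Set
Edge a b = Fin a × Fin b

Nonincident : ∀ {a b} → Edge a b → Edge a b → Set
Nonincident (i , j) (i′ , j′) = (i ≢ i′) × (j ≢ j′)

LinOrder : ℕ → ℕ → Set
LinOrder a b = Vertex a b ↔ Fin (a ℕ.+ b)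

pos : ∀ {a b} → LinOrder a b → Vertex a b → ℕ
pos σ v = toℕ (Inverse.to σ v)

separatesᵇ : ∀ {a b} → LinOrder a b → Edge a b → Edge a b → Bool
separatesᵇ σ (i , j) (i′ , j′) =
  ((pu ⊔ pv) <ᵇ (px ⊓ py)) ∨ ((px ⊔ py) <ᵇ (pu ⊓ pv))
  where
  pu = pos σ (inj₁ i)
  pv = pos σ (inj₂ j)
  px = pos σ (inj₁ i′)
  py = pos σ (inj₂ j′)

sepCount : ∀ {a b} → List (LinOrder a b) → Edge a b → Edge a b → ℕ
sepCount L e f = length (filterᵇ (λ σ → separatesᵇ σ e f) L)

TSeparating : ∀ {a b} → ℕ → List (LinOrder a b) → Set
TSeparating {a} {b} t L =
  (e f : Edge a b) → Nonincident e f → t ℕ.≤ sepCount L e f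

IsPiT : ℕ → ℕ → ℕ → ℕ → Set
IsPiT a b t k =
  (Σ (List (LinOrder a b)) λ L → (length L ≡ k) × TSeparating t L)
  × ((L : List (LinOrder a b)) → TSeparating t L → k ℕ.≤ length L)

-- Fractional separation dimension: π_f(K_{a,b}) = liminf_{t→∞} π_t/t = r,
-- written out via the ε-characterisation of liminf (ε ranging over
-- positive rationals; ℚ is dense in ℝ so this is equivalent):
--  (i)  eventually π_t/t > r - ε, and
--  (ii) π_t/t < r + ε for infinitely many t.
-- (t ranges over positive integers t = suc s.)

ratio : ℕ → ℕ → ℚ
ratio k s = (+ k) ℚ./ suc s

FracSepDimIs : ℕ → ℕ → ℚ → Set
FracSepDimIs a b r =
  (ε : ℚ) → 0ℚ ℚ.< ε →
    (∃ λ N → (s : ℕ) → N ℕ.≤ s → (k : ℕ) → IsPiT a b (suc s) k →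
        r ℚ.- ε ℚ.< ratio k s)
  × ((N : ℕ) → ∃ λ s → N ℕ.≤ s × ∃ λ k → IsPiT a b (suc s) k ×
        ratio k s ℚ.< r ℚ.+ ε)

-- Total division on ℚ (x / 0 := 0); only used with nonzero divisors.

_/?_ : ℚ → ℚ → ℚ
p /? q with q ≟ℚ 0ℚ
... | yes _  = 0ℚ
... | no q≢0 = _÷_ p q {{ℚ.≢-nonZero q≢0}}

ℕtoℚ : ℕ → ℚ
ℕtoℚ n = (+ n) ℚ./ 1

{-# OPTIONS --safe #-}
module Submission where

-- Among the edges spanned by two vertices of each part, a linear ordering separates at most one of the
-- two nonincident pairs, and none exactly when one part's two vertices come first. Put a = m + 1, b = qm.
-- Summing over ordered pairs of edges, an ordering separates Σ ψ(R, X) of them, the sum running over the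
-- vertices v of the part of size b, where R is the number of vertices of that part before v, X is the number
-- of vertices of the other part before v, and ψ(R, X) = 2mRX − (b − 1)X(X − 1). For given R this is a
-- concave parabola in X, maximal over the integers at X = ⌊R / q⌋ + 1. As R runs through 0, …, b − 1 whatever
-- the ordering, the number of separations has a maximum W, attained by A B^q A B^q … A B^q A. Averaging over
-- all pairs gives π_t ≥ t · (number of pairs) / W, and the list of all images of the optimal ordering under
-- permutations of the two parts, repeated n times, attains equality; so π_t is known exactly for infinitely
-- many t.
open import Defs

module Separation where

  import Data.Integer.Properties as ℤ
  open import Algebra.Properties.Semiring.Sum ℤ.+-*-semiring
  open import Data.Bool using (Bool; true; false; T; _∨_)
  open import Data.Empty using (⊥)
  open import Data.Fin using (Fin; zero; suc; toℕ; punchIn)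
  open import Data.Fin.Permutation using (Permutation′; insert; insert-punchIn; _⟨$⟩ʳ_; id; inverseʳ; flip)
  import Data.Fin.Properties as Fin
  open import Data.Integer using (ℤ; +_; -[1+_]; 0ℤ; 1ℤ; _+_; _-_; _*_; -_; _≤_; +≤+)
  open import Data.Integer.Tactic.RingSolver using (solve-∀)
  open import Data.List using (List; []; _∷_; _++_; map; concat; tabulate; length; replicate; cartesianProductWith)
  open import Data.Nat as ℕ using (ℕ; zero; suc; _<ᵇ_; _⊔_; _⊓_; _!)
  open import Data.Nat.DivMod
    using (_/_; _%_; m≡m%n+[m/n]*n; m%n<n; m<n*o⇒m/o<n; m*n/n≡m; m<n⇒m/n≡0; +-distrib-/-∣ʳ; /-monoˡ-≤; m/n*n≤m)
  open import Data.Nat.Divisibility using (divides-refl)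
  import Data.Nat.Properties as ℕ
  open import Data.Product using (_×_; _,_; ∃; proj₁; proj₂)
  open import Data.Rational as ℚ using (ℚ; 0ℚ; 1ℚ; fromℚᵘ)
  import Data.Rational.Properties as ℚ
  open import Data.Rational.Unnormalised as ℚᵘ using (mkℚᵘ; *≡*; *≤*)
  import Data.Rational.Unnormalised.Properties as ℚᵘ
  open import Data.Sum using (inj₁; inj₂)
  open import Data.Sum.Function.Propositional using (_⊎-↔_)
  open import Data.Sum.Properties using (inj₁-injective; inj₂-injective)
  open import Data.Unit using (tt)
  open import Function using (_∘_; Injective)
  open import Function.Bundles using (Inverse)
  open import Function.Construct.Composition using (_↔-∘_)
  open import Function.Construct.Symmetry using (↔-sym)
  open import Relation.Binary.Definitions using (tri<; tri≈; tri>)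
  open import Relation.Binary.PropositionalEquality
    using (_≡_; _≢_; refl; sym; trans; cong; cong₂; subst; subst₂; module ≡-Reasoning)
  open import Relation.Nullary using (Dec; yes; no; contradiction)
  open ≡-Reasoning

  -- Finite sums of integers and the Kronecker delta.

  ∑-const : ∀ n c → ∑[ i < n ] c ≡ + n * c
  ∑-const zero    c = sym (ℤ.*-zeroˡ c)
  ∑-const (suc n) c = trans (cong (_+_ c) (∑-const n c)) (sym (ℤ.suc-* (+ n) c))

  ∑-mono-≤ : ∀ {n} {f g : Fin n → ℤ} → (∀ i → f i ≤ g i) → sum f ≤ sum g
  ∑-mono-≤ {zero}  f≤g = ℤ.≤-refl
  ∑-mono-≤ {suc n} f≤g = ℤ.+-mono-≤ (f≤g zero) (∑-mono-≤ (f≤g ∘ suc))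

  ∑₂-cong : ∀ {m n} {f g : Fin m → Fin n → ℤ} → (∀ i j → f i j ≡ g i j) →
            ∑[ i < m ] ∑[ j < n ] f i j ≡ ∑[ i < m ] ∑[ j < n ] g i j
  ∑₂-cong f≡g = sum-cong-≗ λ i → sum-cong-≗ (f≡g i)

  ∑-distrib-- : ∀ {n} (f g : Fin n → ℤ) → ∑[ i < n ] (f i - g i) ≡ sum f - sum g
  ∑-distrib-- {zero}  f g = refl
  ∑-distrib-- {suc n} f g = trans (cong (_+_ (f zero - g zero)) (∑-distrib-- (f ∘ suc) (g ∘ suc)))
                                  (lemma (f zero) (g zero) _ _)
    where
    lemma : ∀ a b c d → a - b + (c - d) ≡ a + c - (b + d)
    lemma = solve-∀

  ∑₂-distrib-+ : ∀ {m n} (f g : Fin m → Fin n → ℤ) →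
    ∑[ i < m ] ∑[ j < n ] (f i j + g i j) ≡
    ∑[ i < m ] ∑[ j < n ] f i j + ∑[ i < m ] ∑[ j < n ] g i j
  ∑₂-distrib-+ {m} f g = trans (sum-cong-≗ λ i → ∑-distrib-+ (f i) (g i)) (∑-distrib-+ {m} _ _)

  ∑₂-*ˡ : ∀ {m n} c (f : Fin m → Fin n → ℤ) →
    ∑[ i < m ] ∑[ j < n ] (c * f i j) ≡ c * ∑[ i < m ] ∑[ j < n ] f i j
  ∑₂-*ˡ {m} c f = trans (sum-cong-≗ λ i → sym (*-distribˡ-sum c (f i))) (sym (*-distribˡ-sum {m} c _))

  ∑-toℕ-suc : ∀ n (h : ℕ → ℤ) →
    ∑[ i < suc n ] h (toℕ i) ≡ ∑[ i < n ] h (toℕ i) + h n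
  ∑-toℕ-suc n h = trans (sum-init-last {n} (h ∘ toℕ))
    (cong₂ _+_ (sum-cong-≗ {n} λ i → cong h (Fin.toℕ-inject₁ i)) (cong h (Fin.toℕ-fromℕ n)))

  δ : ∀ {n} → Fin n → Fin n → ℤ
  δ zero    zero    = 1ℤ
  δ zero    (suc j) = 0ℤ
  δ (suc i) zero    = 0ℤ
  δ (suc i) (suc j) = δ i j

  δ-refl : ∀ {n} (i : Fin n) → δ i i ≡ 1ℤ
  δ-refl zero    = refl
  δ-refl (suc i) = δ-refl i

  δ-≢ : ∀ {n} {i j : Fin n} → i ≢ j → δ i j ≡ 0ℤ
  δ-≢ {i = zero}  {zero}  i≢j = contradiction refl i≢j
  δ-≢ {i = zero}  {suc j} i≢j = refl
  δ-≢ {i = suc i} {zero}  i≢j = refl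
  δ-≢ {i = suc i} {suc j} i≢j = δ-≢ (i≢j ∘ cong suc)

  ∑-δ : ∀ {n} (i : Fin n) c → ∑[ j < n ] (δ i j * c) ≡ c
  ∑-δ {suc n} zero c = trans (cong₂ _+_ (ℤ.*-identityˡ c) (trans (∑-const n (0ℤ * c)) (ℤ.*-zeroʳ (+ n))))
                             (ℤ.+-identityʳ c)
  ∑-δ (suc i) c = trans (ℤ.+-identityˡ _) (∑-δ i c)

  -- Indicators of comparisons and of separation.

  ι : Bool → ℤ
  ι true  = 1ℤ
  ι false = 0ℤ

  [_<_] : ℕ → ℕ → ℤ
  [ m < n ] = ι (m <ᵇ n)

  [<]-true : ∀ {m n} → m ℕ.< n → [ m < n ] ≡ 1ℤ
  [<]-true {m} {n} m<n with m <ᵇ n | ℕ.<⇒<ᵇ m<n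
  ... | true | _ = refl

  [<]-false : ∀ {m n} → n ℕ.≤ m → [ m < n ] ≡ 0ℤ
  [<]-false {m} {n} n≤m with m <ᵇ n in eq
  ... | false = refl
  ... | true  = contradiction (ℕ.<ᵇ⇒< m n (subst T (sym eq) tt)) (ℕ.≤⇒≯ n≤m)

  -- When `m < n` fails both sides vanish, so an implied comparison is absorbed by the one implying
  -- it. Transitivity of positions enters the later products in this form.
  [<]-⇒ : ∀ {m n o p} → (m ℕ.< n → o ℕ.< p) → [ o < p ] * [ m < n ] ≡ [ m < n ]
  [<]-⇒ {m} {n} {o} {p} imp with m ℕ.<? n
  ... | yes m<n rewrite [<]-true (imp m<n) = ℤ.*-identityˡ _
  ... | no  m≮n rewrite [<]-false (ℕ.≮⇒≥ m≮n) = ℤ.*-zeroʳ [ o < p ]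

  [<]-cong : ∀ {m n o p} → (m ℕ.< n → o ℕ.< p) → (o ℕ.< p → m ℕ.< n) → [ m < n ] ≡ [ o < p ]
  [<]-cong {m} {n} imp imp⁻¹ with m ℕ.<? n
  ... | yes m<n = trans ([<]-true m<n) (sym ([<]-true (imp m<n)))
  ... | no  m≮n = trans ([<]-false (ℕ.≮⇒≥ m≮n)) (sym ([<]-false (ℕ.≮⇒≥ (m≮n ∘ imp⁻¹))))

  [<]-flip : ∀ {m n} → m ≢ n → [ n < m ] ≡ 1ℤ - [ m < n ]
  [<]-flip {m} {n} m≢n with ℕ.<-cmp m n
  ... | tri< m<n _ _ rewrite [<]-true m<n | [<]-false (ℕ.<⇒≤ m<n) = refl
  ... | tri≈ _ m≡n _ = contradiction m≡n m≢n
  ... | tri> _ _ n<m rewrite [<]-true n<m | [<]-false (ℕ.<⇒≤ n<m) = refl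

  [<]-trichotomy : ∀ {n} {r : Fin n → ℕ} → Injective _≡_ _≡_ r →
    ∀ j k → [ r j < r k ] ≡ 1ℤ - δ j k - [ r k < r j ]
  [<]-trichotomy {r = r} inj j k with j Fin.≟ k
  ... | yes refl rewrite δ-refl j | [<]-false (ℕ.≤-refl {r j}) = refl
  ... | no j≢k rewrite δ-≢ j≢k = [<]-flip (j≢k ∘ sym ∘ inj)

  -- Four separate comparisons in place of one between a maximum and a minimum: the factor that is
  -- constant in a sum can then be taken out of it.
  [_,_≺_,_] : ℕ → ℕ → ℕ → ℕ → ℤ
  [ u , v ≺ x , y ] = [ u < x ] * [ u < y ] * [ v < x ] * [ v < y ]

  [⊔<⊓] : ∀ u v x y → [ u ⊔ v < x ⊓ y ] ≡ [ u , v ≺ x , y ]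
  [⊔<⊓] u v x y with (u ⊔ v) ℕ.<? (x ⊓ y)
  ... | yes lt rewrite [<]-true lt
        | [<]-true (ℕ.≤-<-trans (ℕ.m≤m⊔n u v) (ℕ.<-≤-trans lt (ℕ.m⊓n≤m x y)))
        | [<]-true (ℕ.≤-<-trans (ℕ.m≤m⊔n u v) (ℕ.<-≤-trans lt (ℕ.m⊓n≤n x y)))
        | [<]-true (ℕ.≤-<-trans (ℕ.m≤n⊔m u v) (ℕ.<-≤-trans lt (ℕ.m⊓n≤m x y)))
        | [<]-true (ℕ.≤-<-trans (ℕ.m≤n⊔m u v) (ℕ.<-≤-trans lt (ℕ.m⊓n≤n x y))) = refl
  ... | no ≮ rewrite [<]-false (ℕ.≮⇒≥ ≮)
      with u ℕ.<? x | u ℕ.<? y | v ℕ.<? x | v ℕ.<? y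
  ... | no ux | _ | _ | _ rewrite [<]-false (ℕ.≮⇒≥ ux) = refl
  ... | yes ux | no uy | _ | _ rewrite [<]-false (ℕ.≮⇒≥ uy) | ℤ.*-zeroʳ [ u < x ] = refl
  ... | yes ux | yes uy | no vx | _ rewrite [<]-false (ℕ.≮⇒≥ vx) | ℤ.*-zeroʳ ([ u < x ] * [ u < y ]) = refl
  ... | yes ux | yes uy | yes vx | no vy rewrite [<]-false (ℕ.≮⇒≥ vy) = sym (ℤ.*-zeroʳ ([ u < x ] * [ u < y ] * [ v < x ]))
  ... | yes ux | yes uy | yes vx | yes vy = contradiction
        (ℕ.⊔-lub (ℕ.⊓-glb ux uy) (ℕ.⊓-glb vx vy)) ≮

  ι-∨ : ∀ b c → (T b → T c → ⊥) → ι (b ∨ c) ≡ ι b + ι c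
  ι-∨ true  true  ¬both = contradiction tt (¬both tt)
  ι-∨ true  false ¬both = refl
  ι-∨ false c     ¬both = sym (ℤ.+-identityˡ (ι c))

  ι-separates : ∀ {a b} (σ : LinOrder a b) i j i′ j′ →
    ι (separatesᵇ σ (i , j) (i′ , j′)) ≡
      [ pos σ (inj₁ i) , pos σ (inj₂ j) ≺ pos σ (inj₁ i′) , pos σ (inj₂ j′) ] +
      [ pos σ (inj₁ i′) , pos σ (inj₂ j′) ≺ pos σ (inj₁ i) , pos σ (inj₂ j) ]
  ι-separates σ i j i′ j′ = trans
    -- Both disjuncts together would put `u` before `x` and `x` before `u`.
    (ι-∨ _ _ λ before after → ℕ.<-asym
      (ℕ.≤-<-trans (ℕ.m≤m⊔n _ _) (ℕ.<-≤-trans (ℕ.<ᵇ⇒< (u ⊔ v) (x ⊓ y) before) (ℕ.m⊓n≤m _ _)))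
      (ℕ.≤-<-trans (ℕ.m≤m⊔n _ _) (ℕ.<-≤-trans (ℕ.<ᵇ⇒< (x ⊔ y) (u ⊓ v) after) (ℕ.m⊓n≤m _ _))))
    (cong₂ _+_ ([⊔<⊓] u v x y) ([⊔<⊓] x y u v))
    where
    u = pos σ (inj₁ i)
    v = pos σ (inj₂ j)
    x = pos σ (inj₁ i′)
    y = pos σ (inj₂ j′)

  -- The number of separations of one ordering as a sum of `ψ`.

  ψ : ℕ → ℕ → ℤ → ℤ → ℤ
  ψ a b j x = + 2 * (+ a - 1ℤ) * j * x - (+ b - 1ℤ) * (x * x - x)

  -- A linear ordering enters only through the positions p of the one part and r of the other.
  module Count {a b} (p : Fin a → ℕ) (r : Fin b → ℕ) where

    -- Incident pairs are included and contribute 0; each unordered pair of edges is counted twice.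
    -- The sums over `i`, `i′` stand inside because they are evaluated first, for fixed `j`, `j′`.
    separations : ℤ
    separations = ∑[ j < b ] ∑[ j′ < b ] ∑[ i < a ] ∑[ i′ < a ]
      ([ p i , r j ≺ p i′ , r j′ ] + [ p i′ , r j′ ≺ p i , r j ])

    rank : Fin b → ℤ
    rank j = ∑[ k < b ] [ r k < r j ]

    before : Fin b → ℤ
    before j = ∑[ i < a ] [ p i < r j ]

    module _ (p-inj : Injective _≡_ _≡_ p) (r-inj : Injective _≡_ _≡_ r) (p≢r : ∀ i j → p i ≢ r j) where

      -- What is left of `[ p i , r j ≺ p i′ , r j′ ]` without its last factor `[ r j < r j′ ]`,
      -- which does not depend on `i`, `i′`.
      A : Fin b → Fin b → Fin a → Fin a → ℤ
      A j j′ i i′ = [ p i < p i′ ] * [ p i < r j′ ] * [ r j < p i′ ]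

      -- Of the two ways to match up i, i′ with j, j′ at most one is separated, and
      -- none exactly when i, i′ are both before j or both after j′.
      pair-count : ∀ {j j′} → r j ℕ.< r j′ → ∀ i i′ →
        A j j′ i i′ + A j j′ i′ i ≡
        [ p i < r j′ ] + [ p i′ < r j′ ] - [ p i < r j′ ] * [ p i′ < r j′ ]
          - [ p i < r j ] * [ p i′ < r j ] + δ i i′ * ([ p i < r j ] - [ p i < r j′ ])
      pair-count {j} {j′} lt i i′ rewrite [<]-flip (p≢r i j) | [<]-flip (p≢r i′ j) with ℕ.<-cmp (p i) (p i′)
      ... | tri< i<i′ i≢i′ _ rewrite [<]-true i<i′ | [<]-false (ℕ.<⇒≤ i<i′) | δ-≢ (i≢i′ ∘ cong p)
              | [<]-⇒ {p i′} {r j′} {p i} {r j′} (ℕ.<-trans i<i′)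
              | [<]-⇒ {p i′} {r j} {p i} {r j} (ℕ.<-trans i<i′)
              = trans (lemma [ p i < r j ] [ p i < r j′ ] [ p i′ < r j ] [ p i′ < r j′ ])
                  -- If `i′` comes before `j`, then `i` comes before `j′`, by the chain `i`, `i′`,
                  -- `j`, `j′`; the product collapses to the indicator for `i′` and `j`.
                  (trans (cong (λ z → [ p i < r j′ ] - z) ([<]-⇒ {p i′} {r j} {p i} {r j′} λ lt′ → ℕ.<-trans i<i′ (ℕ.<-trans lt′ lt)))
                    (lemma′ [ p i < r j ] [ p i < r j′ ] [ p i′ < r j ] [ p i′ < r j′ ]))
              where
              lemma : ∀ x y x′ y′ → 1ℤ * y * (1ℤ - x′) + 0ℤ * y′ * (1ℤ - x) ≡ y - y * x′
              lemma = solve-∀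
              lemma′ : ∀ x y x′ y′ → y - x′ ≡ y + y′ - y′ - x′ + 0ℤ * (x - y)
              lemma′ = solve-∀
      ... | tri> _ i≢i′ i′<i rewrite [<]-true i′<i | [<]-false (ℕ.<⇒≤ i′<i) | δ-≢ (i≢i′ ∘ cong p)
              | ℤ.*-comm [ p i < r j′ ] [ p i′ < r j′ ] | ℤ.*-comm [ p i < r j ] [ p i′ < r j ]
              | [<]-⇒ {p i} {r j′} {p i′} {r j′} (ℕ.<-trans i′<i)
              | [<]-⇒ {p i} {r j} {p i′} {r j} (ℕ.<-trans i′<i)
              = trans (lemma [ p i < r j ] [ p i < r j′ ] [ p i′ < r j ] [ p i′ < r j′ ])
                  (trans (cong (λ z → [ p i′ < r j′ ] - z) ([<]-⇒ {p i} {r j} {p i′} {r j′} λ lt′ → ℕ.<-trans i′<i (ℕ.<-trans lt′ lt)))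
                    (lemma′ [ p i < r j ] [ p i < r j′ ] [ p i′ < r j ] [ p i′ < r j′ ]))
              where
              lemma : ∀ x y x′ y′ → 0ℤ * y * (1ℤ - x′) + 1ℤ * y′ * (1ℤ - x) ≡ y′ - y′ * x
              lemma = solve-∀
              lemma′ : ∀ x y x′ y′ → y′ - x ≡ y + y′ - y - x + 0ℤ * (x - y)
              lemma′ = solve-∀
      -- On the diagonal the left side is 0, and the `δ` term cancels the rest of the right side.
      ... | tri≈ _ i≡i′ _ with p-inj i≡i′
      ...   | refl rewrite [<]-false (ℕ.≤-refl {p i}) | δ-refl i
              | [<]-⇒ {p i} {r j′} {p i} {r j′} (λ z → z)
              | [<]-⇒ {p i} {r j} {p i} {r j} (λ z → z) = lemma [ p i < r j ] [ p i < r j′ ]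
              where
              lemma : ∀ x y → 0ℤ * y * (1ℤ - x) + 0ℤ * y * (1ℤ - x) ≡ y + y - y - x + 1ℤ * (x - y)
              lemma = solve-∀

      -- The value is a term in `j′` alone minus a term in `j` alone. Hence each can later be summed
      -- freely over the other index.
      sum-pair-count : ∀ {j j′} → r j ℕ.< r j′ →
        ∑[ i < a ] ∑[ i′ < a ] (A j j′ i i′ + A j j′ i′ i) ≡
        (+ 2 * + a * before j′ - before j′ * before j′ - before j′) - (before j * before j - before j)
      sum-pair-count {j} {j′} lt = begin
        ∑[ i < a ] ∑[ i′ < a ] (A j j′ i i′ + A j j′ i′ i)
          ≡⟨ ∑₂-cong (pair-count lt) ⟩
        ∑[ i < a ] ∑[ i′ < a ] (y i + y i′ - y i * y i′ - x i * x i′ + δ i i′ * (x i - y i))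
          ≡⟨ sum-cong-≗ inner ⟩
        ∑[ i < a ] (+ a * y i + Y - y i * Y - x i * X + (x i - y i))
          ≡⟨ linear {a} (λ i → + a * y i) (λ _ → Y) (λ i → y i * Y) (λ i → x i * X) (λ i → x i - y i) ⟩
        ∑[ i < a ] (+ a * y i) + ∑[ i < a ] Y - ∑[ i < a ] (y i * Y) - ∑[ i < a ] (x i * X) + ∑[ i < a ] (x i - y i)
          ≡⟨ cong₂ _+_ (cong₂ _-_ (cong₂ _-_ (cong₂ _+_ (sym (*-distribˡ-sum (+ a) y)) (∑-const a Y))
               (sym (*-distribʳ-sum Y y))) (sym (*-distribʳ-sum X x))) (∑-distrib-- x y) ⟩
        + a * Y + + a * Y - Y * Y - X * X + (X - Y)
          ≡⟨ lemma (+ a) X Y ⟩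
        (+ 2 * + a * Y - Y * Y - Y) - (X * X - X) ∎
        where
        x y : Fin a → ℤ
        x i = [ p i < r j ]
        y i = [ p i < r j′ ]
        X = before j
        Y = before j′
        linear : ∀ {n} (f g h k l : Fin n → ℤ) →
          ∑[ i < n ] (f i + g i - h i - k i + l i) ≡ sum f + sum g - sum h - sum k + sum l
        linear f g h k l = trans (∑-distrib-+ (λ i → f i + g i - h i - k i) l) (cong (_+ sum l)
          (trans (∑-distrib-- (λ i → f i + g i - h i) k) (cong (_- sum k)
            (trans (∑-distrib-- (λ i → f i + g i) h) (cong (_- sum h) (∑-distrib-+ f g))))))
        inner : ∀ i → ∑[ i′ < a ] (y i + y i′ - y i * y i′ - x i * x i′ + δ i i′ * (x i - y i)) ≡
                      + a * y i + Y - y i * Y - x i * X + (x i - y i)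
        inner i = trans
          (linear {a} (λ _ → y i) y (λ i′ → y i * y i′) (λ i′ → x i * x i′) (λ i′ → δ i i′ * (x i - y i)))
          (cong₂ _+_ (cong₂ _-_ (cong₂ _-_ (cong (_+ Y) (∑-const a (y i))) (sym (*-distribˡ-sum (y i) y)))
            (sym (*-distribˡ-sum (x i) x))) (∑-δ i (x i - y i)))
        lemma : ∀ a X Y → a * Y + a * Y - Y * Y - X * X + (X - Y) ≡ (+ 2 * a * Y - Y * Y - Y) - (X * X - X)
        lemma = solve-∀

      E : Fin b → Fin b → Fin a → Fin a → ℤ
      E j j′ i i′ = [ p i , r j ≺ p i′ , r j′ ]

      sum-E : ∀ j j′ → ∑[ i < a ] ∑[ i′ < a ] (E j j′ i i′ + E j j′ i′ i) ≡
        [ r j < r j′ ] * (+ 2 * + a * before j′ - before j′ * before j′ - before j′)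
          - [ r j < r j′ ] * (before j * before j - before j)
      sum-E j j′ = begin
        ∑[ i < a ] ∑[ i′ < a ] (E j j′ i i′ + E j j′ i′ i)
          ≡⟨ ∑₂-cong (λ i i′ → lemma (A j j′ i i′) (A j j′ i′ i) w) ⟩
        ∑[ i < a ] ∑[ i′ < a ] (w * (A j j′ i i′ + A j j′ i′ i))
          ≡⟨ ∑₂-*ˡ w (λ i i′ → A j j′ i i′ + A j j′ i′ i) ⟩
        w * (∑[ i < a ] ∑[ i′ < a ] (A j j′ i i′ + A j j′ i′ i))
          ≡⟨ weighted (r j ℕ.<? r j′) ⟩
        w * (K - F)
          ≡⟨ lemma′ w K F ⟩
        w * K - w * F ∎
        where
        w = [ r j < r j′ ]
        K = + 2 * + a * before j′ - before j′ * before j′ - before j′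
        F = before j * before j - before j
        lemma : ∀ x y w → x * w + y * w ≡ w * (x + y)
        lemma = solve-∀
        lemma′ : ∀ w K F → w * (K - F) ≡ w * K - w * F
        lemma′ = solve-∀
        weighted : Dec (r j ℕ.< r j′) → _
        weighted (yes lt) = cong (w *_) (sum-pair-count lt)
        weighted (no ≮) = trans (cong (_* (∑[ i < a ] ∑[ i′ < a ] (A j j′ i i′ + A j j′ i′ i))) w≡0)
                                (sym (cong (_* (K - F)) w≡0))
          where w≡0 = [<]-false (ℕ.≮⇒≥ ≮)

      above : ∀ j → ∑[ k < b ] [ r j < r k ] ≡ + b - 1ℤ - rank j
      above j = begin
        ∑[ k < b ] [ r j < r k ] ≡⟨ sum-cong-≗ ([<]-trichotomy r-inj j) ⟩
        ∑[ k < b ] (1ℤ - δ j k - [ r k < r j ]) ≡⟨ ∑-distrib-- (λ k → 1ℤ - δ j k) _ ⟩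
        ∑[ k < b ] (1ℤ - δ j k) - rank j ≡⟨ cong (_- rank j) (∑-distrib-- (λ k → 1ℤ) (δ j)) ⟩
        ∑[ k < b ] 1ℤ - ∑[ k < b ] δ j k - rank j ≡⟨ cong (_- rank j) (cong₂ _-_ (trans (∑-const b 1ℤ) (ℤ.*-identityʳ (+ b)))
           (trans (sum-cong-≗ λ k → sym (ℤ.*-identityʳ (δ j k))) (∑-δ j 1ℤ))) ⟩
        + b - 1ℤ - rank j ∎

      -- Exchanging `j` and `j′` in the second half of the summand leaves only pairs with `j` before
      -- `j′`. The term in `j′` then occurs once for each vertex before it, the term in `j` once for
      -- each vertex after it, which gives the weights `rank` and `b - 1 - rank`.
      separations≡∑ψ : separations ≡ ∑[ j < b ] ψ a b (rank j) (before j)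
      separations≡∑ψ = begin
        separations
          ≡⟨ ∑₂-cong (λ j j′ → ∑₂-distrib-+ (E j j′) (λ i i′ → E j′ j i′ i)) ⟩
        ∑[ j < b ] ∑[ j′ < b ] (∑[ i < a ] ∑[ i′ < a ] E j j′ i i′ + ∑[ i < a ] ∑[ i′ < a ] E j′ j i′ i)
          ≡⟨ ∑₂-distrib-+ {b} {b} _ _ ⟩
        ∑[ j < b ] ∑[ j′ < b ] ∑[ i < a ] ∑[ i′ < a ] E j j′ i i′
          + ∑[ j < b ] ∑[ j′ < b ] ∑[ i < a ] ∑[ i′ < a ] E j′ j i′ i
          ≡⟨ cong (_+_ S) (∑-comm {b} {b} λ j j′ → ∑[ i < a ] ∑[ i′ < a ] E j′ j i′ i) ⟩
        ∑[ j < b ] ∑[ j′ < b ] ∑[ i < a ] ∑[ i′ < a ] E j j′ i i′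
          + ∑[ j < b ] ∑[ j′ < b ] ∑[ i < a ] ∑[ i′ < a ] E j j′ i′ i
          ≡⟨ sym (∑₂-distrib-+ {b} {b} _ _) ⟩
        ∑[ j < b ] ∑[ j′ < b ] (∑[ i < a ] ∑[ i′ < a ] E j j′ i i′ + ∑[ i < a ] ∑[ i′ < a ] E j j′ i′ i)
          ≡⟨ ∑₂-cong (λ j j′ → trans (sym (∑₂-distrib-+ (E j j′) (λ i i′ → E j j′ i′ i))) (sum-E j j′)) ⟩
        ∑[ j < b ] ∑[ j′ < b ] ([ r j < r j′ ] * K j′ - [ r j < r j′ ] * F j)
          ≡⟨ trans (sum-cong-≗ λ j → ∑-distrib-- (λ j′ → [ r j < r j′ ] * K j′) _) (∑-distrib-- {b} _ _) ⟩
        ∑[ j < b ] ∑[ j′ < b ] ([ r j < r j′ ] * K j′) - ∑[ j < b ] ∑[ j′ < b ] ([ r j < r j′ ] * F j)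
          ≡⟨ cong₂ _-_
               (trans (∑-comm {b} {b} _) (sum-cong-≗ λ j′ → sym (*-distribʳ-sum (K j′) (λ j → [ r j < r j′ ]))))
               (sum-cong-≗ λ j → trans (sym (*-distribʳ-sum (F j) (λ j′ → [ r j < r j′ ]))) (cong (_* F j) (above j))) ⟩
        ∑[ j < b ] (rank j * K j) - ∑[ j < b ] ((+ b - 1ℤ - rank j) * F j)
          ≡⟨ sym (∑-distrib-- {b} _ _) ⟩
        ∑[ j < b ] (rank j * K j - (+ b - 1ℤ - rank j) * F j)
          ≡⟨ sum-cong-≗ (λ j → lemma (+ a) (+ b) (rank j) (before j)) ⟩
        ∑[ j < b ] ψ a b (rank j) (before j) ∎
        where
        S = ∑[ j < b ] ∑[ j′ < b ] ∑[ i < a ] ∑[ i′ < a ] E j j′ i i′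
        K F : Fin b → ℤ
        K j = + 2 * + a * before j - before j * before j - before j
        F j = before j * before j - before j
        lemma : ∀ a b R X → R * (+ 2 * a * X - X * X - X) - (b - 1ℤ - R) * (X * X - X) ≡
                            + 2 * (a - 1ℤ) * R * X - (b - 1ℤ) * (X * X - X)
        lemma = solve-∀

  -- Sorting by position, and counting initial segments.

  argmin : ∀ {n} (f : Fin (suc n) → ℕ) → ∃ λ i → ∀ j → f i ℕ.≤ f j
  argmin {zero}  f = zero , λ { zero → ℕ.≤-refl }
  argmin {suc n} f with argmin (f ∘ suc)
  ... | i , min with f zero ℕ.≤? f (suc i)
  ...   | yes f0≤ = zero , λ { zero → ℕ.≤-refl ; (suc j) → ℕ.≤-trans f0≤ (min j) }
  ...   | no  f0≰ = suc i , λ { zero → ℕ.<⇒≤ (ℕ.≰⇒> f0≰) ; (suc j) → min j }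

  -- Selection sort: `zero` is sent to the index of the minimum, and `punchIn` skips that index in
  -- the recursive call. The result is a permutation so that sums can be reindexed along it.
  sort : ∀ {n} (f : Fin n → ℕ) → Injective _≡_ _≡_ f →
    ∃ λ (π : Permutation′ n) → ∀ i j → toℕ i ℕ.< toℕ j → f (π ⟨$⟩ʳ i) ℕ.< f (π ⟨$⟩ʳ j)
  sort {zero}  f inj = id , λ ()
  sort {suc n} f inj with argmin f
  ... | k , min with sort (f ∘ punchIn k) (Fin.punchIn-injective k _ _ ∘ inj)
  ...   | π , mono = insert zero k π , mono′
    where
    at-suc : ∀ j → f (insert zero k π ⟨$⟩ʳ suc j) ≡ f (punchIn k (π ⟨$⟩ʳ j))
    at-suc j = cong f (insert-punchIn zero k π j)
    mono′ : ∀ i j → toℕ i ℕ.< toℕ j → f (insert zero k π ⟨$⟩ʳ i) ℕ.< f (insert zero k π ⟨$⟩ʳ j)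
    mono′ zero (suc j) _ = subst (f k ℕ.<_) (sym (at-suc j))
      (ℕ.≤∧≢⇒< (min _) (Fin.punchInᵢ≢i k _ ∘ sym ∘ inj))
    mono′ (suc i) (suc j) (ℕ.s≤s i<j) =
      subst₂ ℕ._<_ (sym (at-suc i)) (sym (at-suc j)) (mono i j i<j)

  ∑[<] : ∀ {n k} → k ℕ.≤ n → ∑[ i < n ] [ toℕ i < k ] ≡ + k
  ∑[<] {n} {zero} _ = trans (∑-const n 0ℤ) (ℤ.*-zeroʳ (+ n))
  ∑[<] {suc n} {suc k} (ℕ.s≤s k≤n) = cong (_+_ 1ℤ) (∑[<] k≤n)

  -- The maximum of `ψ` at each rank, and the sum of these maxima.

  -- ψ j is a concave parabola, and its vertex (j (a − 1)) / (b − 1) + 1/2 is within 1/2 of x₀ by the bounds on c.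
  ψ-max : ∀ a b j x₀ x → let c = (+ b - 1ℤ) * x₀ - (+ a - 1ℤ) * j in
    0ℤ ≤ c → c ≤ + b - 1ℤ → ψ a b j x ≤ ψ a b j x₀
  ψ-max a b j x₀ x 0≤c c≤ = ℤ.0≤i-j⇒j≤i (subst (0ℤ ≤_) (sym (expand (+ a) (+ b) j x₀ x)) (sign (x - x₀)))
    where
    c = (+ b - 1ℤ) * x₀ - (+ a - 1ℤ) * j
    0≤b = ℤ.≤-trans 0≤c c≤
    expand : ∀ a b j x₀ x → (+ 2 * (a - 1ℤ) * j * x₀ - (b - 1ℤ) * (x₀ * x₀ - x₀)) - (+ 2 * (a - 1ℤ) * j * x - (b - 1ℤ) * (x * x - x))
      ≡ (x - x₀) * ((b - 1ℤ) * (x - x₀ - 1ℤ) + + 2 * ((b - 1ℤ) * x₀ - (a - 1ℤ) * j))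
    expand = solve-∀
    0≤* : ∀ {i k} → 0ℤ ≤ i → 0ℤ ≤ k → 0ℤ ≤ i * k
    0≤* {+ i} {+ k} _ _ = subst (0ℤ ≤_) (ℤ.pos-* i k) (+≤+ ℕ.z≤n)
    -- Here `d` is `x - x₀`. For positive `d` both factors are nonnegative by `0 ≤ c`; for negative
    -- `d` both are nonpositive by `c ≤ b - 1`.
    sign : ∀ d → 0ℤ ≤ d * ((+ b - 1ℤ) * (d - 1ℤ) + + 2 * c)
    sign (+ zero) = ℤ.≤-refl
    sign (+ suc d) = 0≤* {+ suc d} (+≤+ ℕ.z≤n) (ℤ.+-mono-≤ (0≤* {k = + suc d - 1ℤ} 0≤b (+≤+ ℕ.z≤n)) (0≤* {+ 2} (+≤+ ℕ.z≤n) 0≤c))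
    sign -[1+ d ] = subst (0ℤ ≤_) (sym (negate (+ b - 1ℤ) (+ d) c))
      (0≤* {1ℤ + + d} (+≤+ ℕ.z≤n) (ℤ.+-mono-≤ (0≤* {k = + d} 0≤b (+≤+ ℕ.z≤n)) (0≤* {+ 2} (+≤+ ℕ.z≤n) (ℤ.i≤j⇒0≤j-i c≤))))
      where
      negate : ∀ b d c → - (1ℤ + d) * (b * (- (1ℤ + d) - 1ℤ) + + 2 * c) ≡ (1ℤ + d) * (b * d + + 2 * (b - c))
      negate = solve-∀

  module Extremal (m q : ℕ) .{{_ : ℕ.NonZero q}} where

    a b : ℕ
    a = suc m
    b = q ℕ.* m

    best : ℕ → ℤ
    best j = + (j / q) + 1ℤ

    -- Divide `j = s + k q` and write `m = 1 + k + k′`, `q = 1 + s + s′`. The quantity `c` of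
    -- `ψ-max` becomes `k′ + s′ m`, and `b - 1 - c` becomes `k + s m`; both are visibly nonnegative.
    ψ-best : ∀ j → j ℕ.< b → ∀ x → ψ a b (+ j) x ≤ ψ a b (+ j) (best j)
    ψ-best j j<b x = ψ-max a b (+ j) (best j) x
      (subst (0ℤ ≤_) (sym (c≡ (+ k) (+ k′) (+ s) (+ s′) m≡ q≡ (ℤ.pos-* q m) j≡)) (0≤ k′ s′))
      (ℤ.0≤i-j⇒j≤i (subst (0ℤ ≤_) (sym (b-1-c≡ (+ k) (+ k′) (+ s) (+ s′) m≡ q≡ (ℤ.pos-* q m) j≡)) (0≤ k s)))
      where
      k = j / q
      s = j % q
      k<m : k ℕ.< m
      k<m = m<n*o⇒m/o<n (subst (j ℕ.<_) (ℕ.*-comm q m) j<b)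
      k′ = m ℕ.∸ suc k
      s′ = q ℕ.∸ suc s
      m≡ : + m ≡ 1ℤ + + k + + k′
      m≡ = cong +_ (sym (ℕ.m+[n∸m]≡n k<m))
      q≡ : + q ≡ 1ℤ + + s + + s′
      q≡ = cong +_ (sym (ℕ.m+[n∸m]≡n (m%n<n j q)))
      j≡ : + j ≡ + s + + k * + q
      j≡ = trans (cong +_ (m≡m%n+[m/n]*n j q)) (cong (_+_ (+ s)) (ℤ.pos-* k q))
      0≤ : ∀ u v → 0ℤ ≤ + u + + v * + m
      0≤ u v = subst (λ z → 0ℤ ≤ + u + z) (ℤ.pos-* v m) (+≤+ ℕ.z≤n)
      c≡ : ∀ {m q b j} k k′ s s′ → m ≡ 1ℤ + k + k′ → q ≡ 1ℤ + s + s′ → b ≡ q * m → j ≡ s + k * q →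
        (b - 1ℤ) * (k + 1ℤ) - m * j ≡ k′ + s′ * m
      c≡ k k′ s s′ refl refl refl refl = identity k k′ s s′
        where
        identity : ∀ k k′ s s′ → ((1ℤ + s + s′) * (1ℤ + k + k′) - 1ℤ) * (k + 1ℤ)
          - (1ℤ + k + k′) * (s + k * (1ℤ + s + s′)) ≡ k′ + s′ * (1ℤ + k + k′)
        identity = solve-∀
      b-1-c≡ : ∀ {m q b j} k k′ s s′ → m ≡ 1ℤ + k + k′ → q ≡ 1ℤ + s + s′ → b ≡ q * m → j ≡ s + k * q →
        b - 1ℤ - ((b - 1ℤ) * (k + 1ℤ) - m * j) ≡ k + s * m
      b-1-c≡ k k′ s s′ refl refl refl refl = identity k k′ s s′
        where
        identity : ∀ k k′ s s′ → (1ℤ + s + s′) * (1ℤ + k + k′) - 1ℤ - (((1ℤ + s + s′) * (1ℤ + k + k′) - 1ℤ) * (k + 1ℤ)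
          - (1ℤ + k + k′) * (s + k * (1ℤ + s + s′))) ≡ k + s * (1ℤ + k + k′)
        identity = solve-∀

    bestTotal : ℕ → ℤ
    bestTotal n = ∑[ j < n ] ψ a b (+ toℕ j) (best (toℕ j))

    -- Six times the sum of ψ over j < kq + s: the first two terms come from the k complete blocks
    -- through Σ l(l + 1) and Σ (l + 1), the last one from the s vertices of the next block.
    G : (m q b k s : ℤ) → ℤ
    G m q b k s = + 2 * (+ 2 * m * q * q - (b - 1ℤ) * q) * (k - 1ℤ) * k * (k + 1ℤ)
      + + 3 * m * q * (q - 1ℤ) * k * (k + 1ℤ)
      + + 6 * (k + 1ℤ) * (+ 2 * m * k * q * s + m * s * (s - 1ℤ) - (b - 1ℤ) * k * s)

    -- Induction over the vertices block by block. The bound is `s ≤ q` and not `s < q` because the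
    -- start of block `k + 1` is reached as the end `s = q` of block `k`. The factor 6 clears the
    -- denominators of the power sums.
    bestTotal-partial : ∀ k s → s ℕ.≤ q →
      + 6 * bestTotal (s ℕ.+ k ℕ.* q) ≡ G (+ m) (+ q) (+ b) (+ k) (+ s)
    bestTotal-partial zero zero _ = base (+ m) (+ q) (+ b)
      where
      base : ∀ m q b → 0ℤ ≡ + 2 * (+ 2 * m * q * q - (b - 1ℤ) * q) * (0ℤ - 1ℤ) * 0ℤ * (0ℤ + 1ℤ)
        + + 3 * m * q * (q - 1ℤ) * 0ℤ * (0ℤ + 1ℤ)
        + + 6 * (0ℤ + 1ℤ) * (+ 2 * m * 0ℤ * q * 0ℤ + m * 0ℤ * (0ℤ - 1ℤ) - (b - 1ℤ) * 0ℤ * 0ℤ)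
      base = solve-∀
    bestTotal-partial (suc k) zero _ =
      trans (bestTotal-partial k q ℕ.≤-refl) (step (+ m) (+ q) (+ b) (+ k))
      where
      step : ∀ m q b k →
        + 2 * (+ 2 * m * q * q - (b - 1ℤ) * q) * (k - 1ℤ) * k * (k + 1ℤ)
        + + 3 * m * q * (q - 1ℤ) * k * (k + 1ℤ)
        + + 6 * (k + 1ℤ) * (+ 2 * m * k * q * q + m * q * (q - 1ℤ) - (b - 1ℤ) * k * q)
        ≡ + 2 * (+ 2 * m * q * q - (b - 1ℤ) * q) * ((1ℤ + k) - 1ℤ) * (1ℤ + k) * ((1ℤ + k) + 1ℤ)
        + + 3 * m * q * (q - 1ℤ) * (1ℤ + k) * ((1ℤ + k) + 1ℤ)
        + + 6 * ((1ℤ + k) + 1ℤ) * (+ 2 * m * (1ℤ + k) * q * 0ℤ + m * 0ℤ * (0ℤ - 1ℤ) - (b - 1ℤ) * (1ℤ + k) * 0ℤ)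
      step = solve-∀
    bestTotal-partial k (suc s) s<q = begin
      + 6 * bestTotal (suc j)
        ≡⟨ cong (+ 6 *_) (∑-toℕ-suc j (λ i → ψ a b (+ i) (best i))) ⟩
      + 6 * (bestTotal j + ψ a b (+ j) (best j))
        ≡⟨ ℤ.*-distribˡ-+ (+ 6) (bestTotal j) (ψ a b (+ j) (best j)) ⟩
      + 6 * bestTotal j + + 6 * ψ a b (+ j) (best j)
        ≡⟨ cong₂ _+_ (bestTotal-partial k s (ℕ.<⇒≤ s<q))
             (cong (+ 6 *_) (cong₂ (ψ a b) (cong (_+_ (+ s)) (ℤ.pos-* k q)) (cong (λ k → + k + 1ℤ) j/q≡k))) ⟩
      G (+ m) (+ q) (+ b) (+ k) (+ s) + + 6 * ψ a b (+ s + + k * + q) (+ k + 1ℤ)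
        ≡⟨ step (+ m) (+ q) (+ b) (+ k) (+ s) ⟩
      G (+ m) (+ q) (+ b) (+ k) (+ suc s) ∎
      where
      j = s ℕ.+ k ℕ.* q
      j/q≡k : j / q ≡ k
      j/q≡k = trans (+-distrib-/-∣ʳ s (divides-refl k)) (cong₂ ℕ._+_ (m<n⇒m/n≡0 s<q) (m*n/n≡m k q))
      step : ∀ m q b k s →
        + 2 * (+ 2 * m * q * q - (b - 1ℤ) * q) * (k - 1ℤ) * k * (k + 1ℤ)
        + + 3 * m * q * (q - 1ℤ) * k * (k + 1ℤ)
        + + 6 * (k + 1ℤ) * (+ 2 * m * k * q * s + m * s * (s - 1ℤ) - (b - 1ℤ) * k * s)
        + + 6 * (+ 2 * m * (s + k * q) * (k + 1ℤ) - (b - 1ℤ) * ((k + 1ℤ) * (k + 1ℤ) - (k + 1ℤ)))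
        ≡ + 2 * (+ 2 * m * q * q - (b - 1ℤ) * q) * (k - 1ℤ) * k * (k + 1ℤ)
        + + 3 * m * q * (q - 1ℤ) * k * (k + 1ℤ)
        + + 6 * (k + 1ℤ) * (+ 2 * m * k * q * (1ℤ + s) + m * (1ℤ + s) * ((1ℤ + s) - 1ℤ) - (b - 1ℤ) * k * (1ℤ + s))
      step = solve-∀

    -- All `m` blocks are complete, so this is `G` at `k = m`, `s = 0`. The last factor is the
    -- denominator in the theorem.
    bestTotal-closed : + 6 * bestTotal b ≡
      + m * (+ m + 1ℤ) * + q * ((+ 2 * + m + 1ℤ) * + m * + q - + m - + 2)
    bestTotal-closed = begin
      + 6 * bestTotal b ≡⟨ cong (λ n → + 6 * bestTotal n) (ℕ.*-comm q m) ⟩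
      + 6 * bestTotal (m ℕ.* q) ≡⟨ bestTotal-partial m 0 ℕ.z≤n ⟩
      G (+ m) (+ q) (+ b) (+ m) 0ℤ ≡⟨ cong (λ b → G (+ m) (+ q) b (+ m) 0ℤ) (ℤ.pos-* q m) ⟩
      G (+ m) (+ q) (+ q * + m) (+ m) 0ℤ ≡⟨ identity (+ m) (+ q) ⟩
      + m * (+ m + 1ℤ) * + q * ((+ 2 * + m + 1ℤ) * + m * + q - + m - + 2) ∎
      where
      identity : ∀ m q →
        + 2 * (+ 2 * m * q * q - (q * m - 1ℤ) * q) * (m - 1ℤ) * m * (m + 1ℤ)
        + + 3 * m * q * (q - 1ℤ) * m * (m + 1ℤ)
        + + 6 * (m + 1ℤ) * (+ 2 * m * m * q * 0ℤ + m * 0ℤ * (0ℤ - 1ℤ) - (q * m - 1ℤ) * m * 0ℤ)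
        ≡ m * (m + 1ℤ) * q * ((+ 2 * m + 1ℤ) * m * q - m - + 2)
      identity = solve-∀

  -- Linear orderings obtained from injective keys.

  separations : ∀ {a b} → (Vertex a b → ℕ) → ℤ
  separations f = Count.separations (f ∘ inj₁) (f ∘ inj₂)

  -- Only relative order enters the count, so an ordering may be replaced by any key that compares
  -- vertices in the same way.
  separations-cong : ∀ {a b} (f g : Vertex a b → ℕ) → (∀ u v → [ f u < f v ] ≡ [ g u < g v ]) →
    separations f ≡ separations g
  separations-cong f g f~g = ∑₂-cong λ j j′ → ∑₂-cong λ i i′ →
    cong₂ _+_ (≺-cong (inj₁ i) (inj₂ j) (inj₁ i′) (inj₂ j′)) (≺-cong (inj₁ i′) (inj₂ j′) (inj₁ i) (inj₂ j))
    where
    ≺-cong : ∀ u v x y → [ f u , f v ≺ f x , f y ] ≡ [ g u , g v ≺ g x , g y ]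
    ≺-cong u v x y = cong₂ _*_ (cong₂ _*_ (cong₂ _*_ (f~g u x) (f~g u y)) (f~g v x)) (f~g v y)

  [<]-mono : ∀ {n} (f : Fin n → ℕ) → (∀ i j → toℕ i ℕ.< toℕ j → f i ℕ.< f j) →
    ∀ i j → [ f i < f j ] ≡ [ toℕ i < toℕ j ]
  [<]-mono f mono i j = [<]-cong reflect (mono i j)
    where
    reflect : f i ℕ.< f j → toℕ i ℕ.< toℕ j
    reflect fi<fj with ℕ.<-cmp (toℕ i) (toℕ j)
    ... | tri< i<j _ _ = i<j
    ... | tri≈ _ i≡j _ = contradiction fi<fj (ℕ.<-irrefl (cong f (Fin.toℕ-injective i≡j)))
    ... | tri> _ _ j<i = contradiction (mono j i j<i) (ℕ.<-asym fi<fj)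

  -- The position of a vertex is the rank of its key, found by sorting. An ordering can thus be
  -- described by keys with gaps instead of an explicit bijection.
  orderBy : ∀ {a b} (key : Vertex a b → ℕ) → Injective _≡_ _≡_ key →
    ∃ λ (σ : LinOrder a b) → ∀ u v → [ pos σ u < pos σ v ] ≡ [ key u < key v ]
  orderBy {a} {b} key inj with sort (key ∘ Inverse.to (Fin.+↔⊎ {a} {b})) (split-inj ∘ inj)
    where
    split-inj : Injective _≡_ _≡_ (Inverse.to (Fin.+↔⊎ {a} {b}))
    split-inj {x} {y} eq = trans (sym (Inverse.strictlyInverseʳ (Fin.+↔⊎ {a} {b}) x))
      (trans (cong (Inverse.from (Fin.+↔⊎ {a} {b})) eq) (Inverse.strictlyInverseʳ (Fin.+↔⊎ {a} {b}) y))
  ... | π , mono = σ , λ u v → sym (trans (cong₂ [_<_] (sym (key-σ u)) (sym (key-σ v)))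
                                ([<]-mono _ mono (Inverse.to σ u) (Inverse.to σ v)))
    where
    σ : LinOrder a b
    σ = flip π ↔-∘ ↔-sym Fin.+↔⊎
    key-σ : ∀ u → key (Inverse.to Fin.+↔⊎ (π ⟨$⟩ʳ Inverse.to σ u)) ≡ key u
    key-σ u = cong key (trans (cong (Inverse.to Fin.+↔⊎) (inverseʳ π)) (Inverse.strictlyInverseˡ (Fin.+↔⊎ {a} {b}) u))

  -- The maximum number of separations and an ordering attaining it.

  module Bound (m q : ℕ) .{{_ : ℕ.NonZero q}} where
    open Extremal m q

    -- After sorting, the ranks are fixed and only `before` still depends on `f`; the sum is then
    -- bounded term by term.
    separations-≤ : (f : Vertex a b → ℕ) → Injective _≡_ _≡_ f → separations f ≤ bestTotal b
    separations-≤ f inj with sort (f ∘ inj₂) (inj₂-injective ∘ inj)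
    ... | π , mono = subst (_≤ bestTotal b) (sym sorted)
        (∑-mono-≤ λ i → ψ-best (toℕ i) (Fin.toℕ<n i) (before (π ⟨$⟩ʳ i)))
      where
      p = λ i → f (inj₁ i)
      r = λ j → f (inj₂ j)
      open Count p r using (rank; before)
      inj₁≢inj₂ : ∀ i j → p i ≢ r j
      inj₁≢inj₂ i j eq with inj eq
      ... | ()
      rank-π : ∀ i → rank (π ⟨$⟩ʳ i) ≡ + toℕ i
      rank-π i = begin
        ∑[ k < b ] [ r k < r (π ⟨$⟩ʳ i) ] ≡⟨ sum-permute (λ k → [ r k < r (π ⟨$⟩ʳ i) ]) π ⟩
        ∑[ k < b ] [ r (π ⟨$⟩ʳ k) < r (π ⟨$⟩ʳ i) ] ≡⟨ sum-cong-≗ (λ k → [<]-mono _ mono k i) ⟩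
        ∑[ k < b ] [ toℕ k < toℕ i ] ≡⟨ ∑[<] (ℕ.<⇒≤ (Fin.toℕ<n i)) ⟩
        + toℕ i ∎
      sorted : separations f ≡ ∑[ i < b ] ψ a b (+ toℕ i) (before (π ⟨$⟩ʳ i))
      sorted = begin
        separations f
          ≡⟨ Count.separations≡∑ψ p r (inj₁-injective ∘ inj) (inj₂-injective ∘ inj) inj₁≢inj₂ ⟩
        ∑[ j < b ] ψ a b (rank j) (before j)
          ≡⟨ sum-permute (λ j → ψ a b (rank j) (before j)) π ⟩
        ∑[ i < b ] ψ a b (rank (π ⟨$⟩ʳ i)) (before (π ⟨$⟩ʳ i))
          ≡⟨ sum-cong-≗ (λ i → cong (λ x → ψ a b x (before (π ⟨$⟩ʳ i))) (rank-π i)) ⟩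
        ∑[ i < b ] ψ a b (+ toℕ i) (before (π ⟨$⟩ʳ i)) ∎

    -- By increasing keys the vertices are listed as A B^q A B^q … A B^q A.
    key : Vertex a b → ℕ
    key (inj₁ i) = 2 ℕ.* (toℕ i ℕ.* q)
    key (inj₂ j) = suc (2 ℕ.* toℕ j)

    key-injective : Injective _≡_ _≡_ key
    key-injective {inj₁ i} {inj₁ i′} eq = cong inj₁ (Fin.toℕ-injective (ℕ.*-cancelʳ-≡ _ _ q (ℕ.*-cancelˡ-≡ _ _ 2 eq)))
    key-injective {inj₁ i} {inj₂ j} eq = contradiction eq (ℕ.even≢odd (toℕ i ℕ.* q) (toℕ j))
    key-injective {inj₂ j} {inj₁ i} eq = contradiction (sym eq) (ℕ.even≢odd (toℕ i ℕ.* q) (toℕ j))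
    key-injective {inj₂ j} {inj₂ j′} eq = cong inj₂ (Fin.toℕ-injective (ℕ.*-cancelˡ-≡ _ _ 2 (ℕ.suc-injective eq)))

    -- The inequality `2 i q < 2 j + 1` says `i ≤ j / q`, so `j / q + 1` vertices of the other part
    -- precede `j`. This is `best j`, and every term of the sum attains its maximum.
    separations-key : separations key ≡ bestTotal b
    separations-key = trans
      (Count.separations≡∑ψ p r (inj₁-injective ∘ key-injective) (inj₂-injective ∘ key-injective) (λ i j → ℕ.even≢odd (toℕ i ℕ.* q) (toℕ j)))
      (sum-cong-≗ λ j → cong₂ (ψ a b) (rank-key j) (before-key j))
      where
      p = λ i → key (inj₁ i)
      r = λ j → key (inj₂ j)
      open Count p r using (rank; before)
      rank-key : ∀ j → rank j ≡ + toℕ j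
      rank-key j = trans (sum-cong-≗ λ k → [<]-mono r (λ i j i<j → ℕ.s<s (ℕ.*-monoʳ-< 2 i<j)) k j)
                         (∑[<] (ℕ.<⇒≤ (Fin.toℕ<n j)))
      before-key : ∀ j → before j ≡ best (toℕ j)
      before-key j = trans (sum-cong-≗ λ i → [<]-cong (down i) (up i))
        (trans (∑[<] (ℕ.s≤s (ℕ.<⇒≤ j/q<m))) (cong +_ (ℕ.+-comm 1 (toℕ j / q))))
        where
        j/q<m : toℕ j / q ℕ.< m
        j/q<m = m<n*o⇒m/o<n (subst (toℕ j ℕ.<_) (ℕ.*-comm q m) (Fin.toℕ<n j))
        down : ∀ i → p i ℕ.< r j → toℕ i ℕ.< suc (toℕ j / q)
        down i lt = ℕ.s≤s (subst (ℕ._≤ toℕ j / q) (m*n/n≡m (toℕ i) q)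
          (/-monoˡ-≤ q (ℕ.*-cancelˡ-≤ 2 (ℕ.s≤s⁻¹ lt))))
        up : ∀ i → toℕ i ℕ.< suc (toℕ j / q) → p i ℕ.< r j
        up i lt = ℕ.s≤s (ℕ.*-monoʳ-≤ 2 (ℕ.≤-trans (ℕ.*-monoˡ-≤ q (ℕ.s≤s⁻¹ lt)) (m/n*n≤m (toℕ j) q)))

  -- Sums over lists.

  ∑ᴸ : ∀ {A : Set} → List A → (A → ℤ) → ℤ
  ∑ᴸ []       f = 0ℤ
  ∑ᴸ (x ∷ xs) f = f x + ∑ᴸ xs f

  module _ {A : Set} where

    ∑ᴸ-cong : ∀ (xs : List A) {f g : A → ℤ} → (∀ x → f x ≡ g x) → ∑ᴸ xs f ≡ ∑ᴸ xs g
    ∑ᴸ-cong []       f≡g = refl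
    ∑ᴸ-cong (x ∷ xs) f≡g = cong₂ _+_ (f≡g x) (∑ᴸ-cong xs f≡g)

    ∑ᴸ-const : ∀ (xs : List A) c → ∑ᴸ xs (λ _ → c) ≡ + length xs * c
    ∑ᴸ-const []       c = sym (ℤ.*-zeroˡ c)
    ∑ᴸ-const (x ∷ xs) c = trans (cong (_+_ c) (∑ᴸ-const xs c)) (sym (ℤ.suc-* (+ length xs) c))

    ∑ᴸ-mono-≤ : ∀ (xs : List A) {f g : A → ℤ} → (∀ x → f x ≤ g x) → ∑ᴸ xs f ≤ ∑ᴸ xs g
    ∑ᴸ-mono-≤ []       f≤g = ℤ.≤-refl
    ∑ᴸ-mono-≤ (x ∷ xs) f≤g = ℤ.+-mono-≤ (f≤g x) (∑ᴸ-mono-≤ xs f≤g)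

    ∑ᴸ-*ˡ : ∀ (xs : List A) c f → ∑ᴸ xs (λ x → c * f x) ≡ c * ∑ᴸ xs f
    ∑ᴸ-*ˡ []       c f = sym (ℤ.*-zeroʳ c)
    ∑ᴸ-*ˡ (x ∷ xs) c f = trans (cong (_+_ (c * f x)) (∑ᴸ-*ˡ xs c f)) (sym (ℤ.*-distribˡ-+ c (f x) (∑ᴸ xs f)))

    ∑ᴸ-++ : ∀ (xs ys : List A) f → ∑ᴸ (xs ++ ys) f ≡ ∑ᴸ xs f + ∑ᴸ ys f
    ∑ᴸ-++ []       ys f = sym (ℤ.+-identityˡ _)
    ∑ᴸ-++ (x ∷ xs) ys f = trans (cong (_+_ (f x)) (∑ᴸ-++ xs ys f)) (sym (ℤ.+-assoc (f x) _ _))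

    ∑ᴸ-map : ∀ {B : Set} (g : B → A) (xs : List B) f → ∑ᴸ (map g xs) f ≡ ∑ᴸ xs (f ∘ g)
    ∑ᴸ-map g []       f = refl
    ∑ᴸ-map g (x ∷ xs) f = cong (_+_ (f (g x))) (∑ᴸ-map g xs f)

    ∑ᴸ-concat-tabulate : ∀ {n} (F : Fin n → List A) f →
      ∑ᴸ (concat (tabulate F)) f ≡ ∑[ j < n ] ∑ᴸ (F j) f
    ∑ᴸ-concat-tabulate {zero}  F f = refl
    ∑ᴸ-concat-tabulate {suc n} F f = trans (∑ᴸ-++ (F zero) _ f)
      (cong (_+_ (∑ᴸ (F zero) f)) (∑ᴸ-concat-tabulate (F ∘ suc) f))

    ∑ᴸ-concat-replicate : ∀ k (xs : List A) f → ∑ᴸ (concat (replicate k xs)) f ≡ + k * ∑ᴸ xs f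
    ∑ᴸ-concat-replicate zero    xs f = sym (ℤ.*-zeroˡ (∑ᴸ xs f))
    ∑ᴸ-concat-replicate (suc k) xs f = trans (∑ᴸ-++ xs _ f)
      (trans (cong (_+_ (∑ᴸ xs f)) (∑ᴸ-concat-replicate k xs f)) (sym (ℤ.suc-* (+ k) (∑ᴸ xs f))))

    ∑ᴸ-cartesianProductWith : ∀ {B C : Set} (h : B → C → A) xs ys f →
      ∑ᴸ (cartesianProductWith h xs ys) f ≡ ∑ᴸ xs λ x → ∑ᴸ ys λ y → f (h x y)
    ∑ᴸ-cartesianProductWith h []       ys f = refl
    ∑ᴸ-cartesianProductWith h (x ∷ xs) ys f = trans (∑ᴸ-++ (map (h x) ys) _ f)
      (cong₂ _+_ (∑ᴸ-map (h x) ys f) (∑ᴸ-cartesianProductWith h xs ys f))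

    ∑ᴸ-∑-comm : ∀ {n} (xs : List A) (f : A → Fin n → ℤ) →
      (∑ᴸ xs λ x → ∑[ i < n ] f x i) ≡ ∑[ i < n ] ∑ᴸ xs (λ x → f x i)
    ∑ᴸ-∑-comm {n} []       f = sym (sum-replicate-zero n)
    ∑ᴸ-∑-comm (x ∷ xs) f = trans (cong (_+_ (sum (f x))) (∑ᴸ-∑-comm xs f)) (sym (∑-distrib-+ (f x) _))

    ∑ᴸ-∑₂-comm : ∀ {m n} (xs : List A) (f : A → Fin m → Fin n → ℤ) →
      (∑ᴸ xs λ x → ∑[ i < m ] ∑[ j < n ] f x i j) ≡ ∑[ i < m ] ∑[ j < n ] ∑ᴸ xs (λ x → f x i j)
    ∑ᴸ-∑₂-comm xs f = trans (∑ᴸ-∑-comm xs (λ x i → sum (f x i))) (sum-cong-≗ λ i → ∑ᴸ-∑-comm xs (λ x → f x i))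

    length≡∑ᴸ : ∀ (xs : List A) → + length xs ≡ ∑ᴸ xs λ _ → 1ℤ
    length≡∑ᴸ xs = sym (trans (∑ᴸ-const xs 1ℤ) (ℤ.*-identityʳ _))

  -- Sums over all permutations.

  -- Classified by the image `j` of `zero`, so that a sum over permutations unfolds into a sum over
  -- `j` and a sum over smaller permutations.
  perms : ∀ n → List (Permutation′ n)
  perms zero    = id ∷ []
  perms (suc n) = concat (tabulate λ j → map (insert zero j) (perms n))

  ∑ᴸ-perms-suc : ∀ n f → ∑ᴸ (perms (suc n)) f ≡ ∑[ j < suc n ] ∑ᴸ (perms n) (f ∘ insert zero j)
  ∑ᴸ-perms-suc n f = trans (∑ᴸ-concat-tabulate (λ j → map (insert zero j) (perms n)) f)
    (sum-cong-≗ λ j → ∑ᴸ-map (insert zero j) (perms n) f)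

  length-perms : ∀ n → + length (perms n) ≡ + (n !)
  length-perms zero    = refl
  length-perms (suc n) = begin
    + length (perms (suc n))                ≡⟨ length≡∑ᴸ (perms (suc n)) ⟩
    ∑ᴸ (perms (suc n)) (λ _ → 1ℤ)           ≡⟨ ∑ᴸ-perms-suc n _ ⟩
    ∑[ j < suc n ] ∑ᴸ (perms n) (λ _ → 1ℤ)  ≡⟨ ∑-const (suc n) _ ⟩
    + suc n * ∑ᴸ (perms n) (λ _ → 1ℤ)       ≡⟨ cong (+ suc n *_) (trans (sym (length≡∑ᴸ (perms n))) (length-perms n)) ⟩
    + suc n * + (n !)                       ≡⟨ sym (ℤ.pos-* (suc n) (n !)) ⟩
    + (suc n !)                             ∎

  ∑-punchIn : ∀ {n} (f : Fin (suc n) → ℤ) j → ∑[ i < n ] f (punchIn j i) ≡ sum f - f j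
  ∑-punchIn {n} f j = trans (cancel (f j) _) (cong (_- f j) (sym (sum-remove {i = j} f)))
    where
    cancel : ∀ x y → y ≡ x + y - x
    cancel = solve-∀

  ∑-punchIn-zero : ∀ {n} (f : Fin (suc n) → ℤ) j → f j ≡ 0ℤ → ∑[ i < n ] f (punchIn j i) ≡ sum f
  ∑-punchIn-zero f j fj≡0 = trans (∑-punchIn f j) (trans (cong (λ z → sum f - z) fj≡0) (ℤ.+-identityʳ (sum f)))

  -- Each value is the image of `i` under exactly `n !` permutations. In the inductive step a value
  -- is missed by just one choice of the image of `zero`.
  ∑-perms₁ : ∀ {n} (i : Fin (suc n)) (g : Fin (suc n) → ℤ) →
    ∑ᴸ (perms (suc n)) (λ π → g (π ⟨$⟩ʳ i)) ≡ + (n !) * sum g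
  ∑-perms₁ {n} zero g = begin
    ∑ᴸ (perms (suc n)) (λ π → g (π ⟨$⟩ʳ zero)) ≡⟨ ∑ᴸ-perms-suc n _ ⟩
    ∑[ j < suc n ] ∑ᴸ (perms n) (λ _ → g j)   ≡⟨ sum-cong-≗ (λ j → trans (∑ᴸ-const (perms n) (g j)) (cong (_* g j) (length-perms n))) ⟩
    ∑[ j < suc n ] (+ (n !) * g j)            ≡⟨ sym (*-distribˡ-sum (+ (n !)) g) ⟩
    + (n !) * sum g                           ∎
  ∑-perms₁ {suc n} (suc i) g = begin
    ∑ᴸ (perms (2 ℕ.+ n)) (λ π → g (π ⟨$⟩ʳ suc i)) ≡⟨ ∑ᴸ-perms-suc (suc n) _ ⟩
    ∑[ j < 2 ℕ.+ n ] ∑ᴸ (perms (suc n)) (λ π → g (insert zero j π ⟨$⟩ʳ suc i))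
      ≡⟨ sum-cong-≗ (λ j → ∑ᴸ-cong (perms (suc n)) λ π → cong g (insert-punchIn zero j π i)) ⟩
    ∑[ j < 2 ℕ.+ n ] ∑ᴸ (perms (suc n)) (λ π → g (punchIn j (π ⟨$⟩ʳ i)))
      ≡⟨ sum-cong-≗ (λ j → trans (∑-perms₁ i (g ∘ punchIn j)) (cong (+ (n !) *_) (∑-punchIn g j))) ⟩
    ∑[ j < 2 ℕ.+ n ] (+ (n !) * (sum g - g j)) ≡⟨ sym (*-distribˡ-sum (+ (n !)) (λ j → sum g - g j)) ⟩
    + (n !) * ∑[ j < 2 ℕ.+ n ] (sum g - g j)
      ≡⟨ cong (+ (n !) *_) (trans (∑-distrib-- (λ _ → sum g) g) (cong (_- sum g) (∑-const (2 ℕ.+ n) (sum g)))) ⟩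
    + (n !) * (+ (2 ℕ.+ n) * sum g - sum g) ≡⟨ lemma (+ (n !)) (+ n) (sum g) ⟩
    + suc n * + (n !) * sum g ≡⟨ cong (_* sum g) (sym (ℤ.pos-* (suc n) (n !))) ⟩
    + (suc n !) * sum g ∎
    where
    lemma : ∀ f n s → f * ((+ 2 + n) * s - s) ≡ (1ℤ + n) * f * s
    lemma = solve-∀

  -- Each ordered pair of distinct values is the image of `i`, `i′` under exactly `n !`
  -- permutations; the zero diagonal allows the sum to run over all pairs.
  ∑-perms₂ : ∀ {n} {i i′ : Fin (2 ℕ.+ n)} → i ≢ i′ → (g : Fin (2 ℕ.+ n) → Fin (2 ℕ.+ n) → ℤ) → (∀ x → g x x ≡ 0ℤ) →
    ∑ᴸ (perms (2 ℕ.+ n)) (λ π → g (π ⟨$⟩ʳ i) (π ⟨$⟩ʳ i′)) ≡ + (n !) * ∑[ x < 2 ℕ.+ n ] ∑[ y < 2 ℕ.+ n ] g x y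
  ∑-perms₂ {i = zero} {zero} i≢i′ g g-diag = contradiction refl i≢i′
  ∑-perms₂ {n} {zero} {suc i} _ g g-diag = begin
    ∑ᴸ (perms (2 ℕ.+ n)) (λ π → g (π ⟨$⟩ʳ zero) (π ⟨$⟩ʳ suc i)) ≡⟨ ∑ᴸ-perms-suc (suc n) _ ⟩
    ∑[ j < 2 ℕ.+ n ] ∑ᴸ (perms (suc n)) (λ π → g j (insert zero j π ⟨$⟩ʳ suc i))
      ≡⟨ sum-cong-≗ (λ j → ∑ᴸ-cong (perms (suc n)) λ π → cong (g j) (insert-punchIn zero j π i)) ⟩
    ∑[ j < 2 ℕ.+ n ] ∑ᴸ (perms (suc n)) (λ π → g j (punchIn j (π ⟨$⟩ʳ i)))
      ≡⟨ sum-cong-≗ (λ j → trans (∑-perms₁ i (g j ∘ punchIn j))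
           (cong (+ (n !) *_) (∑-punchIn-zero (g j) j (g-diag j)))) ⟩
    ∑[ j < 2 ℕ.+ n ] (+ (n !) * sum (g j)) ≡⟨ sym (*-distribˡ-sum (+ (n !)) (λ j → sum (g j))) ⟩
    + (n !) * ∑[ x < 2 ℕ.+ n ] ∑[ y < 2 ℕ.+ n ] g x y ∎
  ∑-perms₂ {n} {suc i} {zero} i≢i′ g g-diag =
    trans (∑-perms₂ {n} {zero} {suc i} (λ ()) (λ x y → g y x) g-diag) (cong (+ (n !) *_) (∑-comm (λ x y → g y x)))
  ∑-perms₂ {zero} {suc zero} {suc zero} i≢i′ g g-diag = contradiction refl i≢i′
  ∑-perms₂ {suc n} {suc i} {suc i′} i≢i′ g g-diag = begin
    ∑ᴸ (perms (3 ℕ.+ n)) (λ π → g (π ⟨$⟩ʳ suc i) (π ⟨$⟩ʳ suc i′)) ≡⟨ ∑ᴸ-perms-suc (2 ℕ.+ n) _ ⟩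
    ∑[ j < 3 ℕ.+ n ] ∑ᴸ (perms (2 ℕ.+ n)) (λ π → g (insert zero j π ⟨$⟩ʳ suc i) (insert zero j π ⟨$⟩ʳ suc i′))
      ≡⟨ sum-cong-≗ (λ j → ∑ᴸ-cong (perms (2 ℕ.+ n)) λ π →
           cong₂ g (insert-punchIn zero j π i) (insert-punchIn zero j π i′)) ⟩
    ∑[ j < 3 ℕ.+ n ] ∑ᴸ (perms (2 ℕ.+ n)) (λ π → g (punchIn j (π ⟨$⟩ʳ i)) (punchIn j (π ⟨$⟩ʳ i′)))
      ≡⟨ sum-cong-≗ (λ j → trans
           (∑-perms₂ (i≢i′ ∘ cong suc) (λ x y → g (punchIn j x) (punchIn j y)) (λ x → g-diag (punchIn j x)))
           (cong (+ (n !) *_) (minor j))) ⟩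
    -- Row and column `j` are deleted from the matrix `g`; the entry they share is `g j j = 0`, so
    -- nothing is added back.
    ∑[ j < 3 ℕ.+ n ] (+ (n !) * (S - sum (g j) - column j)) ≡⟨ sym (*-distribˡ-sum (+ (n !)) (λ j → S - sum (g j) - column j)) ⟩
    + (n !) * ∑[ j < 3 ℕ.+ n ] (S - sum (g j) - column j)
      ≡⟨ cong (+ (n !) *_) total ⟩
    + (n !) * (+ (3 ℕ.+ n) * S - S - S) ≡⟨ lemma (+ (n !)) (+ n) S ⟩
    + suc n * + (n !) * S ≡⟨ cong (_* S) (sym (ℤ.pos-* (suc n) (n !))) ⟩
    + (suc n !) * S ∎
    where
    S = ∑[ x < 3 ℕ.+ n ] ∑[ y < 3 ℕ.+ n ] g x y
    column : Fin (3 ℕ.+ n) → ℤ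
    column y = ∑[ x < 3 ℕ.+ n ] g x y
    minor : ∀ j → ∑[ x < 2 ℕ.+ n ] ∑[ y < 2 ℕ.+ n ] g (punchIn j x) (punchIn j y) ≡ S - sum (g j) - column j
    minor j = begin
      ∑[ x < 2 ℕ.+ n ] ∑[ y < 2 ℕ.+ n ] g (punchIn j x) (punchIn j y)
        ≡⟨ sum-cong-≗ (λ x → ∑-punchIn (g (punchIn j x)) j) ⟩
      ∑[ x < 2 ℕ.+ n ] (sum (g (punchIn j x)) - g (punchIn j x) j)
        ≡⟨ ∑-distrib-- (λ x → sum (g (punchIn j x))) (λ x → g (punchIn j x) j) ⟩
      ∑[ x < 2 ℕ.+ n ] sum (g (punchIn j x)) - ∑[ x < 2 ℕ.+ n ] g (punchIn j x) j
        ≡⟨ cong₂ _-_ (∑-punchIn (λ x → sum (g x)) j)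
             (∑-punchIn-zero (λ x → g x j) j (g-diag j)) ⟩
      S - sum (g j) - column j ∎
    total : ∑[ j < 3 ℕ.+ n ] (S - sum (g j) - column j) ≡ + (3 ℕ.+ n) * S - S - S
    total = begin
      ∑[ j < 3 ℕ.+ n ] (S - sum (g j) - column j)
        ≡⟨ ∑-distrib-- (λ j → S - sum (g j)) column ⟩
      ∑[ j < 3 ℕ.+ n ] (S - sum (g j)) - sum column
        ≡⟨ cong₂ _-_ (trans (∑-distrib-- (λ _ → S) (λ j → sum (g j))) (cong (_- S) (∑-const (3 ℕ.+ n) S)))
             (∑-comm (λ y x → g x y)) ⟩
      + (3 ℕ.+ n) * S - S - S ∎
    lemma : ∀ f n s → f * ((+ 3 + n) * s - s - s) ≡ (1ℤ + n) * f * s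
    lemma = solve-∀

  -- Separation counts of lists, and the orbit of an ordering.

  sepCount≡∑ᴸ : ∀ {a b} (L : List (LinOrder a b)) e f →
    + sepCount L e f ≡ ∑ᴸ L λ σ → ι (separatesᵇ σ e f)
  sepCount≡∑ᴸ []      e f = refl
  sepCount≡∑ᴸ (σ ∷ L) e f with separatesᵇ σ e f
  ... | true  = cong (_+_ 1ℤ) (sepCount≡∑ᴸ L e f)
  ... | false = trans (sepCount≡∑ᴸ L e f) (sym (ℤ.+-identityˡ _))

  separations-pos : ∀ {a b} (σ : LinOrder a b) → separations (pos σ) ≡
    ∑[ j < b ] ∑[ j′ < b ] ∑[ i < a ] ∑[ i′ < a ] ι (separatesᵇ σ (i , j) (i′ , j′))
  separations-pos σ = ∑₂-cong λ j j′ → ∑₂-cong λ i i′ → sym (ι-separates σ i j i′ j′)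

  pos-injective : ∀ {a b} (σ : LinOrder a b) → Injective _≡_ _≡_ (pos σ)
  pos-injective σ {u} {v} eq = trans (sym (Inverse.strictlyInverseʳ σ u))
    (trans (cong (Inverse.from σ) (Fin.toℕ-injective eq)) (Inverse.strictlyInverseʳ σ v))

  -- No position lies below itself. This and its mirror image supply the zero diagonals for
  -- `∑-perms₂`.
  ι-separates-diagˡ : ∀ {a b} (σ : LinOrder a b) i j j′ → ι (separatesᵇ σ (i , j) (i , j′)) ≡ 0ℤ
  ι-separates-diagˡ σ i j j′ rewrite ι-separates σ i j i j′ | [<]-false (ℕ.≤-refl {pos σ (inj₁ i)}) = refl

  ι-separates-diagʳ : ∀ {a b} (σ : LinOrder a b) i j i′ → ι (separatesᵇ σ (i , j) (i′ , j)) ≡ 0ℤ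
  ι-separates-diagʳ σ i j i′ rewrite ι-separates σ i j i′ j | [<]-false (ℕ.≤-refl {pos σ (inj₂ j)}) =
    cong₂ _+_ (ℤ.*-zeroʳ ([ u < x ] * [ u < v ] * [ v < x ])) (ℤ.*-zeroʳ ([ x < u ] * [ x < v ] * [ v < u ]))
    where
    u = pos σ (inj₁ i)
    v = pos σ (inj₂ j)
    x = pos σ (inj₁ i′)

  -- Vertices are relabelled before `σ` places them, so a member of the orbit separates two edges
  -- exactly when `σ` separates their images.
  orbit : ∀ {a b} → LinOrder a b → List (LinOrder a b)
  orbit {a} {b} σ = cartesianProductWith (λ ρ π → σ ↔-∘ (π ⊎-↔ ρ)) (perms b) (perms a)

  length-orbit : ∀ {a b} (σ : LinOrder a b) → + length (orbit σ) ≡ + (b !) * + (a !)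
  length-orbit {a} {b} σ = begin
    + length (orbit σ) ≡⟨ length≡∑ᴸ (orbit σ) ⟩
    ∑ᴸ (orbit σ) (λ _ → 1ℤ) ≡⟨ ∑ᴸ-cartesianProductWith _ (perms b) (perms a) _ ⟩
    ∑ᴸ (perms b) (λ _ → ∑ᴸ (perms a) (λ _ → 1ℤ)) ≡⟨ ∑ᴸ-const (perms b) _ ⟩
    + length (perms b) * ∑ᴸ (perms a) (λ _ → 1ℤ) ≡⟨ cong₂ _*_ (length-perms b) (trans (sym (length≡∑ᴸ (perms a))) (length-perms a)) ⟩
    + (b !) * + (a !) ∎

  -- Applying `∑-perms₂` to each part, the relabellings carry the given pair equally often to every
  -- ordered nonincident pair. The sizes come with equations because `q m` has the form `2 + b` only
  -- propositionally.
  sepCount-orbit : ∀ {a b a′ b′} → a′ ≡ 2 ℕ.+ a → b′ ≡ 2 ℕ.+ b → (σ : LinOrder a′ b′) → ∀ e f → Nonincident e f →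
    + sepCount (orbit σ) e f ≡ + (b !) * (+ (a !) * separations (pos σ))
  sepCount-orbit {a} {b} refl refl σ (i , j) (i′ , j′) (i≢i′ , j≢j′) = begin
    + sepCount (orbit σ) (i , j) (i′ , j′)
      ≡⟨ sepCount≡∑ᴸ (orbit σ) (i , j) (i′ , j′) ⟩
    ∑ᴸ (orbit σ) (λ τ → ι (separatesᵇ τ (i , j) (i′ , j′)))
      ≡⟨ ∑ᴸ-cartesianProductWith _ (perms (2 ℕ.+ b)) (perms (2 ℕ.+ a)) _ ⟩
    ∑ᴸ (perms (2 ℕ.+ b)) (λ ρ → ∑ᴸ (perms (2 ℕ.+ a)) λ π →
        ι (separatesᵇ σ (π ⟨$⟩ʳ i , ρ ⟨$⟩ʳ j) (π ⟨$⟩ʳ i′ , ρ ⟨$⟩ʳ j′)))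
      ≡⟨ ∑ᴸ-cong (perms (2 ℕ.+ b)) (λ ρ → ∑-perms₂ i≢i′
           (λ x x′ → ι (separatesᵇ σ (x , ρ ⟨$⟩ʳ j) (x′ , ρ ⟨$⟩ʳ j′)))
           (λ x → ι-separates-diagˡ σ x (ρ ⟨$⟩ʳ j) (ρ ⟨$⟩ʳ j′))) ⟩
    ∑ᴸ (perms (2 ℕ.+ b)) (λ ρ → + (a !) * row (ρ ⟨$⟩ʳ j) (ρ ⟨$⟩ʳ j′))
      ≡⟨ ∑ᴸ-*ˡ (perms (2 ℕ.+ b)) (+ (a !)) _ ⟩
    + (a !) * ∑ᴸ (perms (2 ℕ.+ b)) (λ ρ → row (ρ ⟨$⟩ʳ j) (ρ ⟨$⟩ʳ j′))
      ≡⟨ cong (+ (a !) *_) (∑-perms₂ j≢j′ row row-diag) ⟩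
    + (a !) * (+ (b !) * ∑[ y < 2 ℕ.+ b ] ∑[ y′ < 2 ℕ.+ b ] row y y′)
      ≡⟨ cong (λ z → + (a !) * (+ (b !) * z)) (sym (separations-pos σ)) ⟩
    + (a !) * (+ (b !) * separations (pos σ))
      ≡⟨ swap (+ (a !)) (+ (b !)) (separations (pos σ)) ⟩
    + (b !) * (+ (a !) * separations (pos σ)) ∎
    where
    row : Fin (2 ℕ.+ b) → Fin (2 ℕ.+ b) → ℤ
    row y y′ = ∑[ x < 2 ℕ.+ a ] ∑[ x′ < 2 ℕ.+ a ] ι (separatesᵇ σ (x , y) (x′ , y′))
    row-diag : ∀ y → row y y ≡ 0ℤ
    row-diag y = trans (∑₂-cong λ x x′ → ι-separates-diagʳ σ x y x′)
      (trans (sum-cong-≗ λ (_ : Fin (2 ℕ.+ a)) → sum-replicate-zero (2 ℕ.+ a)) (sum-replicate-zero (2 ℕ.+ a)))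
    swap : ∀ x y z → x * (y * z) ≡ y * (x * z)
    swap = solve-∀

  -- The lower bound by double counting.

  ∑-offDiagonal : ∀ n c → ∑[ i < n ] ∑[ j < n ] ((1ℤ - δ i j) * c) ≡ (+ n * + n - + n) * c
  ∑-offDiagonal n c = trans (sum-cong-≗ row) (trans (∑-const n (+ n * c - c)) (factor (+ n) c))
    where
    row : ∀ i → ∑[ j < n ] ((1ℤ - δ i j) * c) ≡ + n * c - c
    row i = trans (sum-cong-≗ λ j → expand (δ i j) c)
      (trans (∑-distrib-- (λ _ → c) (λ j → δ i j * c)) (cong₂ _-_ (∑-const n c) (∑-δ i c)))
      where
      expand : ∀ d c → (1ℤ - d) * c ≡ c - d * c
      expand = solve-∀
    factor : ∀ n c → n * (n * c - c) ≡ (n * n - n) * c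
    factor = solve-∀

  -- Double counting of an ordering in `L` together with an ordered pair of edges it separates: each
  -- nonincident pair occurs at least `t` times, each ordering at most `W` times.
  TSeparating⇒≤ : ∀ {a b} {W} → (∀ (σ : LinOrder a b) → separations (pos σ) ≤ W) →
    ∀ {t} L → TSeparating t L → (+ b * + b - + b) * ((+ a * + a - + a) * + t) ≤ + length L * W
  TSeparating⇒≤ {a} {b} {W} ≤W {t} L sep = ℤ.≤-trans (subst (_≤ total) required≡
      (∑-mono-≤ λ j → ∑-mono-≤ λ j′ → ∑-mono-≤ λ i → ∑-mono-≤ λ i′ → term i j i′ j′))
    (subst (_≤ + length L * W) (sym total≡) (subst (∑ᴸ L (λ σ → separations (pos σ)) ≤_) (∑ᴸ-const L W) (∑ᴸ-mono-≤ L ≤W)))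
    where
    total = ∑[ j < b ] ∑[ j′ < b ] ∑[ i < a ] ∑[ i′ < a ] (+ sepCount L (i , j) (i′ , j′))
    -- The factors with `δ` vanish on incident pairs, from which nothing is demanded.
    term : ∀ i j i′ j′ → (1ℤ - δ j j′) * ((1ℤ - δ i i′) * + t) ≤ + sepCount L (i , j) (i′ , j′)
    term i j i′ j′ with i Fin.≟ i′ | j Fin.≟ j′
    ... | yes refl | _ rewrite δ-refl i | ℤ.*-zeroʳ (1ℤ - δ j j′) = +≤+ ℕ.z≤n
    ... | no _ | yes refl rewrite δ-refl j = +≤+ ℕ.z≤n
    ... | no i≢i′ | no j≢j′ rewrite δ-≢ i≢i′ | δ-≢ j≢j′ | ℤ.*-identityˡ (1ℤ * + t) | ℤ.*-identityˡ (+ t) =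
      +≤+ (sep (i , j) (i′ , j′) (i≢i′ , j≢j′))
    required≡ : ∑[ j < b ] ∑[ j′ < b ] ∑[ i < a ] ∑[ i′ < a ] ((1ℤ - δ j j′) * ((1ℤ - δ i i′) * + t)) ≡
      (+ b * + b - + b) * ((+ a * + a - + a) * + t)
    required≡ = begin
      ∑[ j < b ] ∑[ j′ < b ] ∑[ i < a ] ∑[ i′ < a ] ((1ℤ - δ j j′) * ((1ℤ - δ i i′) * + t))
        ≡⟨ ∑₂-cong {b} {b} (λ j j′ → trans (∑₂-*ˡ {a} {a} (1ℤ - δ j j′) (λ i i′ → (1ℤ - δ i i′) * + t))
             (cong ((1ℤ - δ j j′) *_) (∑-offDiagonal a (+ t)))) ⟩
      ∑[ j < b ] ∑[ j′ < b ] ((1ℤ - δ j j′) * ((+ a * + a - + a) * + t))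
        ≡⟨ ∑-offDiagonal b _ ⟩
      (+ b * + b - + b) * ((+ a * + a - + a) * + t) ∎
    total≡ : total ≡ ∑ᴸ L (λ σ → separations (pos σ))
    total≡ = sym (begin
      ∑ᴸ L (λ σ → separations (pos σ)) ≡⟨ ∑ᴸ-cong L separations-pos ⟩
      ∑ᴸ L (λ σ → ∑[ j < b ] ∑[ j′ < b ] ∑[ i < a ] ∑[ i′ < a ] s σ j j′ i i′)
        ≡⟨ ∑ᴸ-∑₂-comm L (λ σ j j′ → ∑[ i < a ] ∑[ i′ < a ] s σ j j′ i i′) ⟩
      ∑[ j < b ] ∑[ j′ < b ] ∑ᴸ L (λ σ → ∑[ i < a ] ∑[ i′ < a ] s σ j j′ i i′)
        ≡⟨ ∑₂-cong (λ j j′ → ∑ᴸ-∑₂-comm L (λ σ → s σ j j′)) ⟩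
      ∑[ j < b ] ∑[ j′ < b ] ∑[ i < a ] ∑[ i′ < a ] ∑ᴸ L (λ σ → s σ j j′ i i′)
        ≡⟨ ∑₂-cong (λ j j′ → ∑₂-cong λ i i′ → sym (sepCount≡∑ᴸ L (i , j) (i′ , j′))) ⟩
      total ∎)
      where
      s : LinOrder a b → Fin b → Fin b → Fin a → Fin a → ℤ
      s σ j j′ i i′ = ι (separatesᵇ σ (i , j) (i′ , j′))

  -- Transfer from integers to rationals.

  -- Rationals are kept in lowest terms, so the law is carried over from unnormalised fractions
  -- along the injective `toℚᵘ`.
  fromℚᵘ-homo-+ : ∀ p q → fromℚᵘ (p ℚᵘ.+ q) ≡ fromℚᵘ p ℚ.+ fromℚᵘ q
  fromℚᵘ-homo-+ p q = ℚ.toℚᵘ-injective (ℚᵘ.≃-trans (ℚ.toℚᵘ-fromℚᵘ (p ℚᵘ.+ q)) (ℚᵘ.≃-sym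
    (ℚᵘ.≃-trans (ℚ.toℚᵘ-homo-+ (fromℚᵘ p) (fromℚᵘ q)) (ℚᵘ.+-cong (ℚ.toℚᵘ-fromℚᵘ p) (ℚ.toℚᵘ-fromℚᵘ q)))))

  fromℚᵘ-homo-* : ∀ p q → fromℚᵘ (p ℚᵘ.* q) ≡ fromℚᵘ p ℚ.* fromℚᵘ q
  fromℚᵘ-homo-* p q = ℚ.toℚᵘ-injective (ℚᵘ.≃-trans (ℚ.toℚᵘ-fromℚᵘ (p ℚᵘ.* q)) (ℚᵘ.≃-sym
    (ℚᵘ.≃-trans (ℚ.toℚᵘ-homo-* (fromℚᵘ p) (fromℚᵘ q)) (ℚᵘ.*-cong (ℚ.toℚᵘ-fromℚᵘ p) (ℚ.toℚᵘ-fromℚᵘ q)))))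

  fromℚᵘ-homo-neg : ∀ p → fromℚᵘ (ℚᵘ.- p) ≡ ℚ.- fromℚᵘ p
  fromℚᵘ-homo-neg p = ℚ.toℚᵘ-injective (ℚᵘ.≃-trans (ℚ.toℚᵘ-fromℚᵘ (ℚᵘ.- p)) (ℚᵘ.≃-sym
    (ℚᵘ.≃-trans (ℚ.toℚᵘ-homo‿- (fromℚᵘ p)) (ℚᵘ.-‿cong (ℚ.toℚᵘ-fromℚᵘ p)))))

  fromℚᵘ-mono-≤ : ∀ {p q} → p ℚᵘ.≤ q → fromℚᵘ p ℚ.≤ fromℚᵘ q
  fromℚᵘ-mono-≤ {p} {q} p≤q = ℚ.toℚᵘ-cancel-≤ (ℚᵘ.≤-respˡ-≃ (ℚᵘ.≃-sym (ℚ.toℚᵘ-fromℚᵘ p))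
    (ℚᵘ.≤-respʳ-≃ (ℚᵘ.≃-sym (ℚ.toℚᵘ-fromℚᵘ q)) p≤q))

  fromℤ : ℤ → ℚ
  fromℤ i = i ℚ./ 1

  fromℤ-- : ∀ i j → fromℤ i ℚ.- fromℤ j ≡ fromℤ (i - j)
  fromℤ-- i j = trans (cong (fromℤ i ℚ.+_) (sym (fromℚᵘ-homo-neg (mkℚᵘ j 0))))
    (trans (sym (fromℚᵘ-homo-+ (mkℚᵘ i 0) (mkℚᵘ (- j) 0)))
      (cong fromℤ (cong₂ _+_ (ℤ.*-identityʳ i) (ℤ.*-identityʳ (- j)))))

  fromℤ-* : ∀ i j → fromℤ i ℚ.* fromℤ j ≡ fromℤ (i * j)
  fromℤ-* i j = sym (fromℚᵘ-homo-* (mkℚᵘ i 0) (mkℚᵘ j 0))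

  fromℤ-mono-≤ : ∀ {i j} → i ≤ j → fromℤ i ℚ.≤ fromℤ j
  fromℤ-mono-≤ {i} {j} i≤j = fromℚᵘ-mono-≤ {mkℚᵘ i 0} {mkℚᵘ j 0} (*≤* (ℤ.*-monoʳ-≤-nonNeg 1ℤ i≤j))

  fromℤ-pos : ∀ n → ℚ.Positive (fromℤ (+ suc n))
  fromℤ-pos n = ℚ.normalize-pos (suc n) 1

  ratio-* : ∀ k s → ratio k s ℚ.* fromℤ (+ suc s) ≡ fromℤ (+ k)
  ratio-* k s = trans (sym (fromℚᵘ-homo-* (mkℚᵘ (+ k) s) (mkℚᵘ (+ suc s) 0)))
    (ℚ.fromℚᵘ-cong {mkℚᵘ (+ k) s ℚᵘ.* mkℚᵘ (+ suc s) 0} {mkℚᵘ (+ k) 0}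
      (*≡* (trans (ℤ.*-identityʳ (+ k * + suc s)) (cong (λ n → + k * + suc n) (sym (ℕ.*-identityʳ s))))))

  module _ (x : ℚ) (A : ℤ) (c : ℕ) (x*c≡A : x ℚ.* fromℤ (+ suc c) ≡ fromℤ A) (k s : ℕ) where
    private
      x-scaled : x ℚ.* fromℤ (+ suc c) ℚ.* fromℤ (+ suc s) ≡ fromℤ (+ suc s * A)
      x-scaled = trans (cong (ℚ._* fromℤ (+ suc s)) x*c≡A)
        (trans (fromℤ-* A (+ suc s)) (cong fromℤ (ℤ.*-comm A (+ suc s))))

      ratio-scaled : ratio k s ℚ.* fromℤ (+ suc c) ℚ.* fromℤ (+ suc s) ≡ fromℤ (+ k * + suc c)
      ratio-scaled = begin
        ratio k s ℚ.* fromℤ (+ suc c) ℚ.* fromℤ (+ suc s)   ≡⟨ ℚ.*-assoc (ratio k s) _ _ ⟩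
        ratio k s ℚ.* (fromℤ (+ suc c) ℚ.* fromℤ (+ suc s)) ≡⟨ cong (ratio k s ℚ.*_) (ℚ.*-comm (fromℤ (+ suc c)) _) ⟩
        ratio k s ℚ.* (fromℤ (+ suc s) ℚ.* fromℤ (+ suc c)) ≡⟨ sym (ℚ.*-assoc (ratio k s) _ _) ⟩
        ratio k s ℚ.* fromℤ (+ suc s) ℚ.* fromℤ (+ suc c)   ≡⟨ cong (ℚ._* fromℤ (+ suc c)) (ratio-* k s) ⟩
        fromℤ (+ k) ℚ.* fromℤ (+ suc c)                     ≡⟨ fromℤ-* (+ k) (+ suc c) ⟩
        fromℤ (+ k * + suc c)                               ∎

    -- Cross-multiplication, `x` being `A / suc c`: the denominators `suc s` and `suc c` are
    -- positive and cancel.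
    ≤-ratio : + suc s * A ≤ + k * + suc c → x ℚ.≤ ratio k s
    ≤-ratio le = ℚ.*-cancelʳ-≤-pos (fromℤ (+ suc c)) {{fromℤ-pos c}} (ℚ.*-cancelʳ-≤-pos (fromℤ (+ suc s)) {{fromℤ-pos s}}
      (subst₂ ℚ._≤_ (sym x-scaled) (sym ratio-scaled) (fromℤ-mono-≤ le)))

    ratio-≤ : + k * + suc c ≤ + suc s * A → ratio k s ℚ.≤ x
    ratio-≤ le = ℚ.*-cancelʳ-≤-pos (fromℤ (+ suc c)) {{fromℤ-pos c}} (ℚ.*-cancelʳ-≤-pos (fromℤ (+ suc s)) {{fromℤ-pos s}}
      (subst₂ ℚ._≤_ (sym ratio-scaled) (sym x-scaled) (fromℤ-mono-≤ le)))

  /?-cancel : ∀ p q .{{_ : ℚ.Positive q}} → (p /? q) ℚ.* q ≡ p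
  /?-cancel p q with q ℚ.≟ 0ℚ
  ... | yes refl = contradiction (ℚ.positive⁻¹ 0ℚ) (ℚ.<-irrefl refl)
  ... | no q≢0 = trans (ℚ.*-assoc p _ q) (trans (cong (p ℚ.*_) (ℚ.*-inverseˡ q {{ℚ.≢-nonZero q≢0}})) (ℚ.*-identityʳ p))

  [1-p/?q]*q : ∀ c p q .{{_ : ℚ.Positive q}} → c ℚ.* (1ℚ ℚ.- (p /? q)) ℚ.* q ≡ c ℚ.* (q ℚ.- p)
  [1-p/?q]*q c p q = begin
    c ℚ.* (1ℚ ℚ.- f) ℚ.* q               ≡⟨ ℚ.*-assoc c (1ℚ ℚ.- f) q ⟩
    c ℚ.* ((1ℚ ℚ.- f) ℚ.* q)             ≡⟨ cong (c ℚ.*_) (ℚ.*-distribʳ-+ q 1ℚ (ℚ.- f)) ⟩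
    c ℚ.* (1ℚ ℚ.* q ℚ.+ (ℚ.- f) ℚ.* q)   ≡⟨ cong (c ℚ.*_) (cong₂ ℚ._+_ (ℚ.*-identityˡ q) (sym (ℚ.neg-distribˡ-* f q))) ⟩
    c ℚ.* (q ℚ.- f ℚ.* q)                ≡⟨ cong (λ z → c ℚ.* (q ℚ.- z)) (/?-cancel p q) ⟩
    c ℚ.* (q ℚ.- p)                      ∎
    where
    f = p /? q

  -- From the maximum number of separations to the fractional separation dimension.

  -- If no ordering has more than W separations and σ₀ attains W, then the fractional
  -- separation dimension is the number of ordered nonincident pairs over W. This quotient is
  -- written x = A / (suc c) in lower terms, suc d / 6 being the factor that was cancelled.
  module Averaging {a b a′ b′ : ℕ} (a≡ : a ≡ 2 ℕ.+ a′) (b≡ : b ≡ 2 ℕ.+ b′)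
    (W : ℤ) (≤W : ∀ (σ : LinOrder a b) → separations (pos σ) ≤ W)
    (σ₀ : LinOrder a b) (σ₀≡W : separations (pos σ₀) ≡ W)
    (x : ℚ) (A : ℤ) (c d : ℕ) (x*Q≡A : x ℚ.* fromℤ (+ suc c) ≡ fromℤ A)
    (pairs≡ : + 6 * ((+ b * + b - + b) * (+ a * + a - + a)) ≡ + suc d * A)
    (W≡ : + 6 * W ≡ + suc d * + suc c)
    where

    pairs*t≡ : ∀ t → + 6 * ((+ b * + b - + b) * ((+ a * + a - + a) * t)) ≡ + suc d * (t * A)
    pairs*t≡ t = begin
      + 6 * ((+ b * + b - + b) * ((+ a * + a - + a) * t)) ≡⟨ assoc (+ 6) (+ b * + b - + b) (+ a * + a - + a) t ⟩
      t * (+ 6 * ((+ b * + b - + b) * (+ a * + a - + a))) ≡⟨ cong (t *_) pairs≡ ⟩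
      t * (+ suc d * A)                                   ≡⟨ swap t (+ suc d) A ⟩
      + suc d * (t * A)                                   ∎
      where
      assoc : ∀ n p q t → n * (p * (q * t)) ≡ t * (n * (p * q))
      assoc = solve-∀
      swap : ∀ x y z → x * (y * z) ≡ y * (x * z)
      swap = solve-∀

    k*W≡ : ∀ k → + 6 * (k * W) ≡ + suc d * (k * + suc c)
    k*W≡ k = trans (swap (+ 6) k W) (trans (cong (k *_) W≡) (swap k (+ suc d) (+ suc c)))
      where
      swap : ∀ x y z → x * (y * z) ≡ y * (x * z)
      swap = solve-∀

    -- The double count with the common factor `suc d` cancelled; it bounds `length L / t` below by
    -- `A / suc c`.
    lower : ∀ {t} (L : List (LinOrder a b)) → TSeparating t L → + t * A ≤ + length L * + suc c
    lower {t} L sep = ℤ.*-cancelˡ-≤-pos (+ t * A) (+ length L * + suc c) (+ suc d)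
      (subst₂ _≤_ (pairs*t≡ (+ t)) (k*W≡ (+ length L)) (ℤ.*-monoˡ-≤-nonNeg (+ 6) (TSeparating⇒≤ ≤W L sep)))

    copies : ℕ → List (LinOrder a b)
    copies n = concat (replicate n (orbit σ₀))

    -- The number of times the orbit of `σ₀` separates each nonincident pair, as an integer whose
    -- positivity is derived below.
    t₀ : ℤ
    t₀ = + (b′ !) * (+ (a′ !) * W)

    sepCount-copies : ∀ n e f → Nonincident e f → + sepCount (copies n) e f ≡ + n * t₀
    sepCount-copies n e f e∦f = begin
      + sepCount (copies n) e f                          ≡⟨ sepCount≡∑ᴸ (copies n) e f ⟩
      ∑ᴸ (copies n) (λ σ → ι (separatesᵇ σ e f))         ≡⟨ ∑ᴸ-concat-replicate n (orbit σ₀) _ ⟩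
      + n * ∑ᴸ (orbit σ₀) (λ σ → ι (separatesᵇ σ e f))   ≡⟨ cong (+ n *_) (sym (sepCount≡∑ᴸ (orbit σ₀) e f)) ⟩
      + n * + sepCount (orbit σ₀) e f                    ≡⟨ cong (+ n *_) (sepCount-orbit a≡ b≡ σ₀ e f e∦f) ⟩
      + n * (+ (b′ !) * (+ (a′ !) * separations (pos σ₀)))
        ≡⟨ cong (λ z → + n * (+ (b′ !) * (+ (a′ !) * z))) σ₀≡W ⟩
      + n * t₀                                           ∎

    length-copies : ∀ n → + length (copies n) ≡ + n * (+ (b !) * + (a !))
    length-copies n = trans (length≡∑ᴸ (copies n)) (trans (∑ᴸ-concat-replicate n (orbit σ₀) _)
      (cong (+ n *_) (trans (sym (length≡∑ᴸ (orbit σ₀))) (length-orbit σ₀))))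

    -- Equality in the double count: `(b * b - b) * b′ !` is `b !`, likewise for `a`, and the
    -- product of the factorials is the size of the orbit.
    pairs*copies : ∀ n → (+ b * + b - + b) * ((+ a * + a - + a) * (+ n * t₀)) ≡ + length (copies n) * W
    pairs*copies n = begin
      (+ b * + b - + b) * ((+ a * + a - + a) * (+ n * (+ (b′ !) * (+ (a′ !) * W))))
        ≡⟨ regroup (+ b * + b - + b) (+ a * + a - + a) (+ n) (+ (a′ !)) (+ (b′ !)) W ⟩
      + n * ((+ b * + b - + b) * + (b′ !) * ((+ a * + a - + a) * + (a′ !))) * W
        ≡⟨ cong (λ z → + n * z * W) (cong₂ _*_ (falling b≡) (falling a≡)) ⟩
      + n * (+ (b !) * + (a !)) * W
        ≡⟨ cong (_* W) (sym (length-copies n)) ⟩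
      + length (copies n) * W ∎
      where
      regroup : ∀ p q n f g w → p * (q * (n * (g * (f * w)))) ≡ n * (p * g * (q * f)) * w
      regroup = solve-∀
      expand : ∀ n f → ((+ 2 + n) * (+ 2 + n) - (+ 2 + n)) * f ≡ (+ 2 + n) * ((1ℤ + n) * f)
      expand = solve-∀
      falling : ∀ {n n′} → n ≡ 2 ℕ.+ n′ → (+ n * + n - + n) * + (n′ !) ≡ + (n !)
      falling {n′ = n′} refl = trans (expand (+ n′) (+ (n′ !)))
        (sym (trans (ℤ.pos-* (2 ℕ.+ n′) (suc n′ !)) (cong (+ (2 ℕ.+ n′) *_) (ℤ.pos-* (suc n′) (n′ !)))))

    tight : ∀ n → + n * t₀ * A ≡ + length (copies n) * + suc c
    tight n = ℤ.*-cancelˡ-≡ (+ suc d) _ _ (trans (sym (pairs*t≡ (+ n * t₀)))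
      (trans (cong (+ 6 *_) (pairs*copies n)) (k*W≡ (+ length (copies n)))))

    nonincident-pair : ∃ λ e → ∃ λ f → Nonincident {a} {b} e f
    nonincident-pair = pair a≡ b≡
      where
      pair : ∀ {a b} → a ≡ 2 ℕ.+ a′ → b ≡ 2 ℕ.+ b′ → ∃ λ e → ∃ λ f → Nonincident {a} {b} e f
      pair refl refl = (zero , zero) , (suc zero , suc zero) , (λ ()) , (λ ())

    -- Otherwise `tight` for a single copy would equate 0 with `b ! * a ! * suc c`.
    t₀≢0 : t₀ ≢ 0ℤ
    t₀≢0 t₀≡0 = contradiction (ℤ.+-injective (begin
        + (b ! ℕ.* a ! ℕ.* suc c)           ≡⟨ ℤ.pos-* (b ! ℕ.* a !) (suc c) ⟩
        + (b ! ℕ.* a !) * + suc c           ≡⟨ cong (_* + suc c) (ℤ.pos-* (b !) (a !)) ⟩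
        + (b !) * + (a !) * + suc c         ≡⟨ cong (_* + suc c) (sym (ℤ.*-identityˡ (+ (b !) * + (a !)))) ⟩
        1ℤ * (+ (b !) * + (a !)) * + suc c  ≡⟨ cong (_* + suc c) (sym (length-copies 1)) ⟩
        + length (copies 1) * + suc c       ≡⟨ sym (tight 1) ⟩
        1ℤ * t₀ * A                         ≡⟨ cong (λ t → 1ℤ * t * A) t₀≡0 ⟩
        0ℤ                                  ∎))
      (ℕ.≢-nonZero⁻¹ _ {{ℕ.m*n≢0 (b ! ℕ.* a !) (suc c) {{ℕ.m*n≢0 (b !) (a !) {{b ℕ.!≢0}} {{a ℕ.!≢0}}}}}})

    -- Being the separation count of an actual nonincident pair, `t₀` is a natural number, and it is
    -- not 0.
    t₀-positive : ∃ λ t → t₀ ≡ + suc t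
    t₀-positive = let e , f , e∦f = nonincident-pair in
      positive (sepCount (copies 1) e f) (trans (sym (ℤ.*-identityˡ t₀)) (sym (sepCount-copies 1 e f e∦f)))
      where
      positive : ∀ n → t₀ ≡ + n → ∃ λ t → t₀ ≡ + suc t
      positive zero    t₀≡0 = contradiction t₀≡0 t₀≢0
      positive (suc t) t₀≡  = t , t₀≡

    exactly : ∀ N {t} → t₀ ≡ + suc t → let s = t ℕ.+ N ℕ.* suc t ; k = length (copies (suc N)) in
      IsPiT a b (suc s) k × + suc s * A ≡ + k * + suc c
    exactly N {t} t₀≡ = ((copies (suc N) , refl , separating) , minimal) , exact
      where
      -- Chosen so that `suc s` unfolds to `suc N * suc t`, the count reached by `suc N` copies.
      s = t ℕ.+ N ℕ.* suc t
      t≡ : + suc N * t₀ ≡ + suc s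
      t≡ = trans (cong (+ suc N *_) t₀≡) (sym (ℤ.pos-* (suc N) (suc t)))
      exact : + suc s * A ≡ + length (copies (suc N)) * + suc c
      exact = trans (cong (_* A) (sym t≡)) (tight (suc N))
      separating : TSeparating (suc s) (copies (suc N))
      separating e f e∦f = ℕ.≤-reflexive (ℤ.+-injective (sym (trans (sepCount-copies (suc N) e f e∦f) t≡)))
      minimal : ∀ L → TSeparating (suc s) L → length (copies (suc N)) ℕ.≤ length L
      minimal L sep = ℤ.drop‿+≤+ (ℤ.*-cancelʳ-≤-pos (+ length (copies (suc N))) (+ length L) (+ suc c)
        (subst (_≤ + length L * + suc c) exact (lower L sep)))

    fracSepDim : FracSepDimIs a b x
    -- The lower bound holds for every positive `t`, so the threshold is 0.
    fracSepDim ε 0<ε = (0 , eventually-above) , infinitely-often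
      where
      x-ε<x : x ℚ.- ε ℚ.< x
      x-ε<x = subst (x ℚ.- ε ℚ.<_) (ℚ.+-identityʳ x) (ℚ.+-monoʳ-< x (ℚ.neg-antimono-< 0<ε))
      x<x+ε : x ℚ.< x ℚ.+ ε
      x<x+ε = subst (ℚ._< x ℚ.+ ε) (ℚ.+-identityʳ x) (ℚ.+-monoʳ-< x 0<ε)

      eventually-above : ∀ s → 0 ℕ.≤ s → ∀ k → IsPiT a b (suc s) k → x ℚ.- ε ℚ.< ratio k s
      eventually-above s _ k ((L , refl , sep) , _) = ℚ.<-≤-trans x-ε<x (≤-ratio x A c x*Q≡A k s (lower L sep))

      infinitely-often : ∀ N → ∃ λ s → N ℕ.≤ s × ∃ λ k → IsPiT a b (suc s) k × ratio k s ℚ.< x ℚ.+ ε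
      infinitely-often N = let t , t₀≡ = t₀-positive
                               πₜ , exact = exactly N t₀≡ in
        t ℕ.+ N ℕ.* suc t , ℕ.≤-trans (ℕ.m≤m*n N (suc t)) (ℕ.m≤n+m (N ℕ.* suc t) t) ,
        length (copies (suc N)) , πₜ ,
        ℚ.≤-<-trans (ratio-≤ x A c x*Q≡A (length (copies (suc N))) (t ℕ.+ N ℕ.* suc t) (ℤ.≤-reflexive (sym exact))) x<x+ε

  -- The closed form for the parameters of the theorem.

  module Instance (m′ q′ b′ : ℕ) (b≡ : suc q′ ℕ.* suc m′ ≡ 2 ℕ.+ b′) where

    m q : ℕ
    m = suc m′
    q = suc q′

    open Extremal m q
    open Bound m q

    -- Numerator and denominator of the fraction in the theorem, over the integers; `A` is
    -- `3 (1 - P / Q)` multiplied by `Q`.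
    P Q A : ℤ
    P = + ((q ℕ.+ 1) ℕ.* m) - + 2
    Q = + ((2 ℕ.* m ℕ.+ 1) ℕ.* m ℕ.* q) - + m - + 2
    A = + 3 * (Q - P)

    -- `suc c` is `Q` expanded in `b′` and `m′`, which makes its positivity visible. `suc d` is
    -- `m (m + 1) q`, the factor common to six times the number of pairs and six times the maximum.
    c d : ℕ
    c = 2 ℕ.+ (3 ℕ.* b′ ℕ.+ 3 ℕ.* m′ ℕ.+ 2 ℕ.* m′ ℕ.* b′)
    d = ℕ.pred (m ℕ.* (m ℕ.+ 1) ℕ.* q)

    Q-cast : Q ≡ (+ 2 * + m + 1ℤ) * + m * + q - + m - + 2
    Q-cast = cong (λ z → z - + m - + 2) (trans (ℤ.pos-* ((2 ℕ.* m ℕ.+ 1) ℕ.* m) q)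
      (cong (_* + q) (trans (ℤ.pos-* (2 ℕ.* m ℕ.+ 1) m) (cong (λ z → (z + 1ℤ) * + m) (ℤ.pos-* 2 m)))))

    P-cast : P ≡ (+ q + 1ℤ) * + m - + 2
    P-cast = cong (_- + 2) (ℤ.pos-* (q ℕ.+ 1) m)

    d-cast : + suc d ≡ + m * (+ m + 1ℤ) * + q
    d-cast = trans (ℤ.pos-* (m ℕ.* (m ℕ.+ 1)) q) (cong (_* + q) (ℤ.pos-* m (m ℕ.+ 1)))

    Q≡ : Q ≡ + suc c
    Q≡ = begin
      Q ≡⟨ Q-cast ⟩
      (+ 2 * + m + 1ℤ) * + m * + q - + m - + 2 ≡⟨ collect (+ m) (+ q) ⟩
      (+ 2 * + m + 1ℤ) * (+ q * + m) - + m - + 2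
        ≡⟨ cong (λ z → (+ 2 * + m + 1ℤ) * z - + m - + 2) (trans (sym (ℤ.pos-* q m)) (cong +_ b≡)) ⟩
      (+ 2 * + m + 1ℤ) * (+ 2 + + b′) - + m - + 2 ≡⟨ expand (+ m′) (+ b′) ⟩
      + 3 + (+ 3 * + b′ + + 3 * + m′ + + 2 * + m′ * + b′)
        ≡⟨ cong (_+_ (+ 3)) (cong₂ _+_ (cong₂ _+_ (sym (ℤ.pos-* 3 b′)) (sym (ℤ.pos-* 3 m′)))
             (trans (cong (_* + b′) (sym (ℤ.pos-* 2 m′))) (sym (ℤ.pos-* (2 ℕ.* m′) b′)))) ⟩
      + suc c ∎
      where
      collect : ∀ m q → (+ 2 * m + 1ℤ) * m * q - m - + 2 ≡ (+ 2 * m + 1ℤ) * (q * m) - m - + 2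
      collect = solve-∀
      expand : ∀ m b → (+ 2 * (1ℤ + m) + 1ℤ) * (+ 2 + b) - (1ℤ + m) - + 2 ≡ + 3 + (+ 3 * b + + 3 * m + + 2 * m * b)
      expand = solve-∀

    pairs≡ : + 6 * ((+ b * + b - + b) * (+ a * + a - + a)) ≡ + suc d * A
    pairs≡ = begin
      + 6 * ((+ b * + b - + b) * (+ a * + a - + a))
        ≡⟨ cong (λ z → + 6 * ((z * z - z) * (+ a * + a - + a))) (ℤ.pos-* q m) ⟩
      + 6 * ((+ q * + m * (+ q * + m) - + q * + m) * (+ a * + a - + a))
        ≡⟨ identity (+ m) (+ q) ⟩
      + m * (+ m + 1ℤ) * + q * (+ 3 * (((+ 2 * + m + 1ℤ) * + m * + q - + m - + 2) - ((+ q + 1ℤ) * + m - + 2)))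
        ≡⟨ sym (cong₂ (λ x y → x * (+ 3 * y)) d-cast (cong₂ _-_ Q-cast P-cast)) ⟩
      + suc d * A ∎
      where
      identity : ∀ m q → + 6 * ((q * m * (q * m) - q * m) * ((1ℤ + m) * (1ℤ + m) - (1ℤ + m))) ≡
        m * (m + 1ℤ) * q * (+ 3 * (((+ 2 * m + 1ℤ) * m * q - m - + 2) - ((q + 1ℤ) * m - + 2)))
      identity = solve-∀

    W≡ : + 6 * bestTotal b ≡ + suc d * + suc c
    W≡ = trans bestTotal-closed (sym (cong₂ _*_ d-cast (trans (sym Q≡) Q-cast)))

    σ₀ : LinOrder a b
    σ₀ = proj₁ (orderBy key key-injective)

    separations-σ₀ : separations (pos σ₀) ≡ bestTotal b
    separations-σ₀ = trans (separations-cong (pos σ₀) key (proj₂ (orderBy key key-injective))) separations-key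

    r : ℚ
    r = ℕtoℚ 3 ℚ.* (1ℚ ℚ.- ((ℕtoℚ ((q ℕ.+ 1) ℕ.* m) ℚ.- ℕtoℚ 2)
          /? ((ℕtoℚ ((2 ℕ.* m ℕ.+ 1) ℕ.* m ℕ.* q) ℚ.- ℕtoℚ m) ℚ.- ℕtoℚ 2)))

    r*Q≡A : r ℚ.* fromℤ (+ suc c) ≡ fromℤ A
    r*Q≡A = begin
      r ℚ.* fromℤ (+ suc c) ≡⟨ cong (ℚ._* fromℤ (+ suc c)) r≡ ⟩
      ℕtoℚ 3 ℚ.* (1ℚ ℚ.- (fromℤ P /? fromℤ (+ suc c))) ℚ.* fromℤ (+ suc c)
        ≡⟨ [1-p/?q]*q (ℕtoℚ 3) (fromℤ P) (fromℤ (+ suc c)) {{fromℤ-pos c}} ⟩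
      ℕtoℚ 3 ℚ.* (fromℤ (+ suc c) ℚ.- fromℤ P) ≡⟨ cong (λ z → ℕtoℚ 3 ℚ.* (fromℤ z ℚ.- fromℤ P)) (sym Q≡) ⟩
      ℕtoℚ 3 ℚ.* (fromℤ Q ℚ.- fromℤ P) ≡⟨ cong (ℕtoℚ 3 ℚ.*_) (fromℤ-- Q P) ⟩
      fromℤ (+ 3) ℚ.* fromℤ (Q - P) ≡⟨ fromℤ-* (+ 3) (Q - P) ⟩
      fromℤ A ∎
      where
      r≡ : r ≡ ℕtoℚ 3 ℚ.* (1ℚ ℚ.- (fromℤ P /? fromℤ (+ suc c)))
      r≡ = cong₂ (λ x y → ℕtoℚ 3 ℚ.* (1ℚ ℚ.- (x /? y)))
        (fromℤ-- (+ ((q ℕ.+ 1) ℕ.* m)) (+ 2))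
        (trans (cong (ℚ._- ℕtoℚ 2) (fromℤ-- (+ ((2 ℕ.* m ℕ.+ 1) ℕ.* m ℕ.* q)) (+ m)))
          (trans (fromℤ-- (+ ((2 ℕ.* m ℕ.+ 1) ℕ.* m ℕ.* q) - + m) (+ 2)) (cong fromℤ Q≡)))

    result : FracSepDimIs a b r
    result = Averaging.fracSepDim refl b≡ (bestTotal b) (λ σ → separations-≤ (pos σ) (pos-injective σ))
      σ₀ separations-σ₀ r A c d r*Q≡A pairs≡ W≡

open import Data.Nat using (ℕ; zero; suc; _*_; _<_)
open import Data.Nat.Properties using (+-comm; *-comm; m+[n∸m]≡n)
open import Data.Rational using (ℚ; _-_; 1ℚ) renaming (_*_ to _*ℚ_; _+_ to _+ℚ_)
open import Relation.Binary.PropositionalEquality using (subst; sym)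

mainTheorem10 : (m q : ℕ) → 0 < m → 0 < q → 1 < m * q →
    FracSepDimIs (m Data.Nat.+ 1) (q * m)
    (ℕtoℚ 3 *ℚ (1ℚ - ((ℕtoℚ ((q Data.Nat.+ 1) * m) - ℕtoℚ 2)
    /? ((ℕtoℚ ((2 * m Data.Nat.+ 1) * m * q) - ℕtoℚ m) - ℕtoℚ 2))))
mainTheorem10 zero    q       ()
mainTheorem10 (suc m) zero    _ ()
mainTheorem10 (suc m) (suc q) _ _ 1<mq =
  subst (λ a → FracSepDimIs a (suc q * suc m) r) (+-comm 1 (suc m)) result
  where
  -- The hypothesis `1 < m q` provides two vertices in the part of size `q m`, so subtracting 2 is
  -- exact.
  open Separation.Instance m q (suc q * suc m Data.Nat.∸ 2)
    (sym (m+[n∸m]≡n (subst (1 <_) (*-comm (suc m) (suc q)) 1<mq)))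
    using (r; result)
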